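{- Let $k,m$ be positive integers and let $\mathcal F_1$ and $\mathcal F_2$ be intersecting families of $k$-multisets with elements from $[m]$. If $m > \frac{1}{2}(1+\sqrt5)k + 1$, then \[|\mathcal F_1 \cup \mathcal F_2| \leq \binom{m+k-2}{k-1} + \binom{m+k-3}{k-1}.\] Equality holds if and only if there exists a $2$-set $\{x,y\} \subset [m]$ such that $\mathcal F_1 \cup \mathcal F_2$ consists of all $k$-multisets of $[m]$ that intersect $\{x,y\}$.
   Context: A $k$-multiset of $[m]=\{1,\dots,m\}$ is a multiset of cardinality $k$ (counting repetitions) with elements from $[m]$; $\mathrm{m}(i,A)$ denotes the multiplicity of $i$ in $A$. The intersection of multisets $A,B$ is the multiset $C$ with $\mathrm{m}(i,C)=\min\{\mathrm{m}(i,A),\mathrm{m}(i,B)\}$ (a set is regarded as a multiset with all multiplicities one). A family is intersecting if every two members have nonempty intersection. -}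

module Defs where

open import Data.Nat using (ℕ; _⊓_; _≤_)
open import Data.Vec using (Vec; lookup; zipWith; sum)
open import Data.Fin using (Fin)
open import Data.List using (List)
open import Data.List.Membership.Propositional using (_∈_)
open import Data.Product using (∃)
open import Relation.Binary.PropositionalEquality using (_≡_)
open import Relation.Nullary using (¬_)

-- A multiset with elements from [m] = Fin m, given by its multiplicity vector:
-- m(i, A) = lookup A i.
Multiset : ℕ → Set
Multiset m = Vec ℕ m

mult : ∀ {m} → Fin m → Multiset m → ℕ
mult i A = lookup A i

card : ∀ {m} → Multiset m → ℕ
card A = sum A

IsKMultiset : ∀ {m} → ℕ → Multiset m → Set
IsKMultiset k A = card A ≡ k

_∩_ : ∀ {m} → Multiset m → Multiset m → Multiset m
A ∩ B = zipWith _⊓_ A B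

NonEmpty : ∀ {m} → Multiset m → Set
NonEmpty A = ¬ (card A ≡ 0)

Family : ℕ → Set
Family m = List (Multiset m)

Intersecting : ∀ {m} → Family m → Set
Intersecting F = ∀ {A B} → A ∈ F → B ∈ F → NonEmpty (A ∩ B)

FamilyOfKMultisets : ∀ {m} → ℕ → Family m → Set
FamilyOfKMultisets k F = ∀ {A} → A ∈ F → IsKMultiset k A

{-# OPTIONS --safe #-}
module Submission where

-- A k-multiset of [m] is encoded as a k-subset of [n], n = m+k-1, whose trace on [m] is its support;
-- intersecting families of multisets become intersecting families A, B of k-sets.  Shifting A to the
-- left and simultaneously B to the right does not decrease |A ∪ B|, so let A be left-shifted and B
-- right-shifted.  It then suffices that the members of A not containing both 1 and n are at most as
-- many as the k-sets containing 1 but not n, and symmetrically for B.  The members missing 1 form a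
-- shifted 2-intersecting family; splitting them at the first time they contain two points more than
-- they miss and applying the LYM inequality to the tails bounds them by a family of complements of
-- nonmembers.  The estimate is strict unless A is a star.  For the equality case, being a pair of
-- stars is pulled back through each shift, using that Kneser graphs K(N,κ) with N ≥ 2κ+1 are connected.

open import Defs
open import Data.Bool using (Bool; true; false; _∧_; _∨_; not; if_then_else_; f≤t; b≤b)
import Data.Bool as Bool
import Data.Bool.Properties as Boolₚ
open import Data.Fin using (Fin; zero; suc; inject₁; fromℕ; _↑ˡ_)
import Data.Fin as Fin
open import Data.Fin.Properties using (any?; ↑ˡ-injective)
import Data.Fin.Properties as Finₚ
open import Data.Fin.Subset using (Subset; ∣_∣; ∁) renaming (_∩_ to _∩ˢ_; _∪_ to _∪ˢ_; ⊥ to ∅ˢ)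
open import Data.Fin.Subset.Properties using (anySubset?; ∣p∣≤n)
open import Data.List using (length)
import Data.List as List
open import Data.List.Membership.Propositional using (_∈_)
import Data.List.Membership.DecPropositional as DecMembership
import Data.List.Relation.Unary.All as All
import Data.List.Relation.Unary.AllPairs as AllPairs
import Data.List.Relation.Unary.Any as Any
open import Data.List.Relation.Unary.Unique.Propositional using (Unique)
open import Data.Nat using (ℕ; zero; suc; _+_; _*_; _∸_; _⊓_; _<_; _≤_; z≤n; s≤s; s≤s⁻¹; >-nonZero)
open import Data.Nat.Combinatorics using (_C_; nCk+nC[k+1]≡[n+1]C[k+1]; k>n⇒nCk≡0)
open import Data.Nat.Properties
open import Data.Nat.Tactic.RingSolver using (solve-∀)
open import Data.Product using (_×_; _,_; proj₁; proj₂; Σ-syntax; ∃-syntax)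
open import Data.Sum using (_⊎_; inj₁; inj₂; [_,_]′)
open import Data.Vec using (Vec; []; _∷_; _∷ʳ_; _++_; _[_]≔_; lookup; replicate; reverse; sum; zipWith)
import Data.Vec as Vec
open import Data.Vec.Properties
  using (≡-dec; ++-injective; lookup-++ˡ; lookup-map; lookup-replicate; lookup-zipWith; lookup∘update; lookup∘update′;
         reverse-∷; reverse-involutive)
open import Data.Vec.Relation.Binary.Pointwise.Inductive using (Pointwise; []; _∷_)
import Data.Vec.Relation.Binary.Pointwise.Inductive as Pointwise
open import Function using (_∘_; const)
open import Function.Bundles using (_⇔_; mk⇔; Equivalence)
open import Relation.Binary.PropositionalEquality
open import Relation.Nullary using (¬_; Dec; yes; no; contradiction)
open import Relation.Nullary.Decidable using (does; dec-true; _×-dec_; _⊎-dec_)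

-- The golden ratio marks the point where a binomial comparison turns. Put M = n - k = m - 1.
-- Members missing 1 are traded for k-sets through 1 that are complements of larger members. LYM
-- makes the trade profitable once C(M+s+1, s) < C(M+s, s+1), that is (M+s+1)(s+1) < M(M+1), roughly
-- M > φs with φ = (1+√5)/2. The lower-order terms cost more than M > φk provides; but every point
-- of a set that has been scanned lowers both s and M by one and so adds φ - 1 to the surplus of M
-- over φs. Two such points suffice, and a lead of two guarantees them. In the equality case the
-- obstacle is that a shift can turn an intersecting family that is no star into a star. What helps
-- is abundance: at equality a k-set through one centre that avoids the other can only come from one
-- of the two shifted families, so that family contains all of them.

private variable
  m n κ : ℕ

-- Sums over the k-subsets

SetFamily : ℕ → Set
SetFamily n = Subset n → Bool

infixr 6 _∪ᶠ_
_∪ᶠ_ : SetFamily n → SetFamily n → SetFamily n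
(A ∪ᶠ B) X = A X ∨ B X

∑ : ℕ → (Subset n → ℕ) → ℕ
∑ {zero}  zero    f = f []
∑ {zero}  (suc k) f = 0
∑ {suc n} zero    f = ∑ zero (f ∘ (false ∷_))
∑ {suc n} (suc k) f = ∑ (suc k) (f ∘ (false ∷_)) + ∑ k (f ∘ (true ∷_))

∑-mono : ∀ k {f g : Subset n → ℕ} → (∀ X → ∣ X ∣ ≡ k → f X ≤ g X) → ∑ k f ≤ ∑ k g
∑-mono {zero}  zero    f≤g = f≤g [] refl
∑-mono {zero}  (suc k) f≤g = z≤n
∑-mono {suc n} zero    f≤g = ∑-mono zero (λ X → f≤g (false ∷ X))
∑-mono {suc n} (suc k) f≤g =
  +-mono-≤ (∑-mono (suc k) (λ X → f≤g (false ∷ X)))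
           (∑-mono k (λ X e → f≤g (true ∷ X) (cong suc e)))

∑-cong : ∀ k {f g : Subset n → ℕ} → (∀ X → ∣ X ∣ ≡ k → f X ≡ g X) → ∑ k f ≡ ∑ k g
∑-cong k f≡g = ≤-antisym (∑-mono k (λ X e → ≤-reflexive (f≡g X e)))
                         (∑-mono k (λ X e → ≤-reflexive (sym (f≡g X e))))

∑-mono-< : ∀ k {f g : Subset n → ℕ} → (∀ X → ∣ X ∣ ≡ k → f X ≤ g X) →
           ∀ X → ∣ X ∣ ≡ k → f X < g X → ∑ k f < ∑ k g
∑-mono-< {zero}  zero    f≤g [] e f<g = f<g
∑-mono-< {suc n} zero    f≤g (false ∷ X) e f<g = ∑-mono-< zero (λ Y → f≤g (false ∷ Y)) X e f<g
∑-mono-< {suc n} (suc k) f≤g (false ∷ X) e f<g =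
  +-mono-<-≤ (∑-mono-< (suc k) (λ Y → f≤g (false ∷ Y)) X e f<g)
             (∑-mono k (λ Y e → f≤g (true ∷ Y) (cong suc e)))
∑-mono-< {suc n} (suc k) f≤g (true ∷ X) e f<g =
  +-mono-≤-< (∑-mono (suc k) (λ Y → f≤g (false ∷ Y)))
             (∑-mono-< k (λ Y e → f≤g (true ∷ Y) (cong suc e)) X (suc-injective e) f<g)

∑-saturated : ∀ k {f g : Subset n → ℕ} → (∀ X → ∣ X ∣ ≡ k → f X ≤ g X) →
              ∑ k g ≤ ∑ k f → ∀ X → ∣ X ∣ ≡ k → g X ≤ f X
∑-saturated k f≤g ∑g≤∑f X e = ≮⇒≥ λ f<g → ≤⇒≯ ∑g≤∑f (∑-mono-< k f≤g X e f<g)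

interchange : ∀ a b c d → (a + b) + (c + d) ≡ (a + c) + (b + d)
interchange = solve-∀

∑-+ : ∀ k (f g : Subset n → ℕ) → ∑ k (λ X → f X + g X) ≡ ∑ k f + ∑ k g
∑-+ {zero}  zero    f g = refl
∑-+ {zero}  (suc k) f g = refl
∑-+ {suc n} zero    f g = ∑-+ zero (f ∘ (false ∷_)) (g ∘ (false ∷_))
∑-+ {suc n} (suc k) f g =
  trans (cong₂ _+_ (∑-+ (suc k) (f ∘ (false ∷_)) (g ∘ (false ∷_))) (∑-+ k (f ∘ (true ∷_)) (g ∘ (true ∷_))))
        (interchange (∑ (suc k) (f ∘ (false ∷_))) _ _ _)

∑-zero : ∀ k {f : Subset n → ℕ} → (∀ X → ∣ X ∣ ≡ k → f X ≡ 0) → ∑ k f ≡ 0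
∑-zero {zero}  zero    f≡0 = f≡0 [] refl
∑-zero {zero}  (suc k) f≡0 = refl
∑-zero {suc n} zero    f≡0 = ∑-zero zero (λ X → f≡0 (false ∷ X))
∑-zero {suc n} (suc k) f≡0 = cong₂ _+_ (∑-zero (suc k) (λ X → f≡0 (false ∷ X)))
                                       (∑-zero k (λ X e → f≡0 (true ∷ X) (cong suc e)))

∑-above : ∀ k (f : Subset n → ℕ) → n < k → ∑ k f ≡ 0
∑-above {zero}  (suc k) f n<k       = refl
∑-above {suc n} (suc k) f (s≤s n<k) =
  cong₂ _+_ (∑-above (suc k) _ (m≤n⇒m≤1+n n<k)) (∑-above k _ n<k)

∑-∁ : ∀ k j (f : Subset n → ℕ) → k + j ≡ n → ∑ k (f ∘ ∁) ≡ ∑ j f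
∑-∁ {zero}  zero    zero    f refl = refl
∑-∁ {suc n} zero    (suc j) f refl =
  sym (trans (cong (_+ ∑ n (f ∘ (true ∷_))) (∑-above (suc n) (f ∘ (false ∷_)) ≤-refl))
             (sym (∑-∁ zero n (f ∘ (true ∷_)) refl)))
∑-∁ {suc n} (suc k) zero    f e =
  cong₂ _+_ (∑-above (suc k) _ (≤-reflexive (cong suc (trans (sym (suc-injective e)) (+-identityʳ k)))))
            (∑-∁ k zero (f ∘ (false ∷_)) (suc-injective e))
∑-∁ {suc n} (suc k) (suc j) f e =
  trans (cong₂ _+_ (∑-∁ (suc k) j (f ∘ (true ∷_)) (suc-injective (trans (cong suc (sym (+-suc k j))) e)))
                   (∑-∁ k (suc j) (f ∘ (false ∷_)) (suc-injective e)))
        (+-comm (∑ j (f ∘ (true ∷_))) _)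

∑-∷ʳ-zero : (f : Subset (suc n) → ℕ) → ∑ 0 f ≡ ∑ 0 (f ∘ (_∷ʳ false))
∑-∷ʳ-zero {zero}  f = refl
∑-∷ʳ-zero {suc n} f = ∑-∷ʳ-zero (f ∘ (false ∷_))

∑-∷ʳ-suc : ∀ k (f : Subset (suc n) → ℕ) →
           ∑ (suc k) f ≡ ∑ (suc k) (f ∘ (_∷ʳ false)) + ∑ k (f ∘ (_∷ʳ true))
∑-∷ʳ-suc {zero}  zero    f = refl
∑-∷ʳ-suc {zero}  (suc k) f = refl
∑-∷ʳ-suc {suc n} zero    f =
  trans (cong₂ _+_ (∑-∷ʳ-suc zero (f ∘ (false ∷_))) (∑-∷ʳ-zero (f ∘ (true ∷_))))
        (swap-last (∑ 1 (f ∘ (_∷ʳ false) ∘ (false ∷_))) _ _)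
  where
  swap-last : ∀ a b c → (a + b) + c ≡ (a + c) + b
  swap-last = solve-∀
∑-∷ʳ-suc {suc n} (suc k) f =
  trans (cong₂ _+_ (∑-∷ʳ-suc (suc k) (f ∘ (false ∷_))) (∑-∷ʳ-suc k (f ∘ (true ∷_))))
        (interchange (∑ (suc (suc k)) (f ∘ (false ∷_) ∘ (_∷ʳ false))) _ _ _)

∑-reverse : ∀ k (f : Subset n → ℕ) → ∑ k (f ∘ reverse) ≡ ∑ k f
∑-reverse {zero}  zero    f = refl
∑-reverse {zero}  (suc k) f = refl
∑-reverse {suc n} zero    f =
  trans (∑-cong 0 (λ X _ → cong f (reverse-∷ false X)))
        (trans (∑-reverse 0 (f ∘ (_∷ʳ false))) (sym (∑-∷ʳ-zero f)))
∑-reverse {suc n} (suc k) f =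
  trans (cong₂ _+_ (trans (∑-cong (suc k) (λ X _ → cong f (reverse-∷ false X))) (∑-reverse (suc k) (f ∘ (_∷ʳ false))))
                   (trans (∑-cong k (λ X _ → cong f (reverse-∷ true X))) (∑-reverse k (f ∘ (_∷ʳ true)))))
        (sym (∑-∷ʳ-suc k f))

-- Levels of a family and binomial coefficients

⟦_⟧ : Bool → ℕ
⟦ true ⟧  = 1
⟦ false ⟧ = 0

⟦⟧-mono : ∀ {a b} → (a ≡ true → b ≡ true) → ⟦ a ⟧ ≤ ⟦ b ⟧
⟦⟧-mono {false} h = z≤n
⟦⟧-mono {true}  h = ≤-reflexive (cong ⟦_⟧ (sym (h refl)))

⟦⟧-reflects-≤ : ∀ {a b} → ⟦ a ⟧ ≤ ⟦ b ⟧ → a ≡ true → b ≡ true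
⟦⟧-reflects-≤ {true} {true} _ _ = refl

level : ℕ → SetFamily n → ℕ
level k A = ∑ k (⟦_⟧ ∘ A)

level-mono : ∀ k {A B : SetFamily n} → (∀ X → ∣ X ∣ ≡ k → A X ≡ true → B X ≡ true) → level k A ≤ level k B
level-mono k h = ∑-mono k (λ X e → ⟦⟧-mono (h X e))

level-cong : ∀ k {A B : SetFamily n} → (∀ X → A X ≡ B X) → level k A ≡ level k B
level-cong k h = ∑-cong k (λ X _ → cong ⟦_⟧ (h X))

level-saturated : ∀ k {A B : SetFamily n} → (∀ X → ∣ X ∣ ≡ k → A X ≡ true → B X ≡ true) →
                  level k B ≤ level k A → ∀ X → ∣ X ∣ ≡ k → B X ≡ true → A X ≡ true
level-saturated k h le X e = ⟦⟧-reflects-≤ (∑-saturated k (λ Y e′ → ⟦⟧-mono (h Y e′)) le X e)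

level-empty : ∀ k {A : SetFamily n} → (∀ X → ∣ X ∣ ≡ k → A X ≡ false) → level k A ≡ 0
level-empty k h = ∑-zero k (λ X e → cong ⟦_⟧ (h X e))

level≡0⇒empty : ∀ k {A : SetFamily n} → level k A ≡ 0 → ∀ X → ∣ X ∣ ≡ k → A X ≡ false
level≡0⇒empty k {A} l≡0 X e with A X in AX
... | false = refl
... | true  = contradiction (∑-mono-< k {λ _ → 0} {⟦_⟧ ∘ A} (λ _ _ → z≤n) X e (≤-reflexive (sym (cong ⟦_⟧ AX))))
                            (≤⇒≯ (≤-trans (≤-reflexive l≡0) z≤n))

-- As the size of a level of the full family, it satisfies Pascal's rule by computation, and its
-- symmetry comes from `∑-∁`.
binomial : ℕ → ℕ → ℕ
binomial n k = ∑ {n} k (const 1)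

binomial≡C : ∀ n k → binomial n k ≡ n C k
binomial≡C zero    zero    = refl
binomial≡C zero    (suc k) = sym (k>n⇒nCk≡0 {0} {suc k} (s≤s z≤n))
binomial≡C (suc n) zero    = binomial≡C n zero
binomial≡C (suc n) (suc k) = trans (+-comm (binomial n (suc k)) (binomial n k))
  (trans (cong₂ _+_ (binomial≡C n k) (binomial≡C n (suc k))) (nCk+nC[k+1]≡[n+1]C[k+1] n k))

-- Levels of up-closed families

infix 4 _⊑_
_⊑_ : Subset n → Subset n → Set
_⊑_ = Pointwise Bool._≤_

⊑-refl : {X : Subset n} → X ⊑ X
⊑-refl = Pointwise.refl b≤b

⊑-∷ʳ : ∀ {X Y : Subset n} {a b} → X ⊑ Y → a Bool.≤ b → X ∷ʳ a ⊑ Y ∷ʳ b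
⊑-∷ʳ []       q = q ∷ []
⊑-∷ʳ (p ∷ ps) q = p ∷ ⊑-∷ʳ ps q

UpClosed : SetFamily n → Set
UpClosed A = ∀ {X Y} → X ⊑ Y → A X ≡ true → A Y ≡ true

UpClosed-∷ : ∀ {A : SetFamily (suc n)} b → UpClosed A → UpClosed (A ∘ (b ∷_))
UpClosed-∷ b up X⊑Y = up (b≤b ∷ X⊑Y)

-- Double counting of pairs that differ by one added point: a member of size `i` has `r` such
-- supersets, all in `A`, and a set of size `i + 1` has `i + 1` such subsets. In the induction the
-- pairs differing in the first point give `p₀ ≤ q₁`; the others lie in one of the two halves.
level-step : ∀ {A : SetFamily n} → UpClosed A → ∀ i r → i + r ≡ n →
             level i A * r ≤ level (suc i) A * suc i
level-step {zero} {A} up zero zero refl = ≤-trans (≤-reflexive (*-zeroʳ (level 0 A))) z≤n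
level-step {suc n} {A} up zero r refl = begin
  a * suc n             ≡⟨ *-suc a n ⟩
  a + a * n             ≤⟨ +-mono-≤ (level-mono 0 {A ∘ (false ∷_)} (λ X _ → up (f≤t ∷ ⊑-refl)))
                                     (level-step (UpClosed-∷ {A = A} false up) 0 n refl) ⟩
  c + b * 1             ≡⟨ regroup c b ⟩
  (b + c) * 1           ∎
  where
  open ≤-Reasoning
  a b c : ℕ
  a = level 0 (A ∘ (false ∷_))
  b = level 1 (A ∘ (false ∷_))
  c = level 0 (A ∘ (true ∷_))
  regroup : ∀ c b → c + b * 1 ≡ (b + c) * 1
  regroup = solve-∀
level-step {suc n} {A} up (suc i) zero e = ≤-trans (≤-reflexive (*-zeroʳ (level (suc i) A))) z≤n
level-step {suc n} {A} up (suc i) (suc r) e = begin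
  (p₀ + p₁) * suc r                       ≡⟨ regroup₁ p₀ p₁ r ⟩
  p₀ + (p₀ * r + p₁ * suc r)              ≤⟨ +-mono-≤ (level-mono (suc i) {A ∘ (false ∷_)} (λ X _ → up (f≤t ∷ ⊑-refl)))
                                              (+-mono-≤ (level-step (UpClosed-∷ {A = A} false up) (suc i) r
                                                          (trans (sym (+-suc i r)) (suc-injective e)))
                                                        (level-step (UpClosed-∷ {A = A} true up) i (suc r) (suc-injective e))) ⟩
  q₁ + (q₀ * suc (suc i) + q₁ * suc i)    ≡⟨ regroup₂ q₀ q₁ i ⟩
  (q₀ + q₁) * suc (suc i)                 ∎
  where
  open ≤-Reasoning
  p₀ p₁ q₀ q₁ : ℕ
  p₀ = level (suc i) (A ∘ (false ∷_))
  p₁ = level i (A ∘ (true ∷_))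
  q₀ = level (suc (suc i)) (A ∘ (false ∷_))
  q₁ = level (suc i) (A ∘ (true ∷_))
  regroup₁ : ∀ p₀ p₁ r → (p₀ + p₁) * suc r ≡ p₀ + (p₀ * r + p₁ * suc r)
  regroup₁ = solve-∀
  regroup₂ : ∀ q₀ q₁ i → q₁ + (q₀ * suc (suc i) + q₁ * suc i) ≡ (q₀ + q₁) * suc (suc i)
  regroup₂ = solve-∀

binomial-0 : ∀ n → binomial n 0 ≡ 1
binomial-0 zero    = refl
binomial-0 (suc n) = binomial-0 n

-- The full family attains equality in `level-step`.
binomial-step : ∀ {n} i r → i + r ≡ n → binomial n (suc i) * suc i ≡ binomial n i * r
binomial-step {zero}  zero    zero    refl = refl
binomial-step {suc n} zero    r       refl = begin
  (binomial n 1 + binomial n 0) * 1  ≡⟨ regroup (binomial n 1) (binomial n 0) ⟩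
  binomial n 0 + binomial n 1 * 1    ≡⟨ cong (binomial n 0 +_) (binomial-step 0 n refl) ⟩
  binomial n 0 + binomial n 0 * n    ≡⟨ *-suc (binomial n 0) n ⟨
  binomial n 0 * suc n               ∎
  where
  open ≡-Reasoning
  regroup : ∀ b a → (b + a) * 1 ≡ a + b * 1
  regroup = solve-∀
binomial-step {suc n} (suc i) zero e = begin
  binomial (suc n) (suc (suc i)) * suc (suc i)
    ≡⟨ cong (_* suc (suc i)) (∑-above {suc n} (suc (suc i)) (const 1) (s≤s (≤-reflexive (trans (sym e) (+-identityʳ (suc i)))))) ⟩
  0
    ≡⟨ *-zeroʳ (binomial (suc n) (suc i)) ⟨
  binomial (suc n) (suc i) * 0 ∎
  where open ≡-Reasoning
binomial-step {suc n} (suc i) (suc r) e = begin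
  (c + b) * suc (suc i)                 ≡⟨ regroup₁ b c i ⟩
  b + (c * suc (suc i) + b * suc i)     ≡⟨ cong (b +_) (cong₂ _+_
                                            (binomial-step (suc i) r (trans (sym (+-suc i r)) (suc-injective e)))
                                            (binomial-step i (suc r) (suc-injective e))) ⟩
  b + (b * r + a * suc r)               ≡⟨ regroup₂ a b r ⟩
  (b + a) * suc r                       ∎
  where
  open ≡-Reasoning
  a b c : ℕ
  a = binomial n i
  b = binomial n (suc i)
  c = binomial n (suc (suc i))
  regroup₁ : ∀ b c i → (c + b) * suc (suc i) ≡ b + (c * suc (suc i) + b * suc i)
  regroup₁ = solve-∀
  regroup₂ : ∀ a b r → b + (b * r + a * suc r) ≡ (b + a) * suc r
  regroup₂ = solve-∀

binomial-pos : ∀ {n} k → k ≤ n → 0 < binomial n k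
binomial-pos {n}     zero    k≤n       = ≤-reflexive (sym (binomial-0 n))
binomial-pos {suc n} (suc k) (s≤s k≤n) = ≤-trans (binomial-pos k k≤n) (m≤n+m _ (binomial n (suc k)))

binomial-sym : ∀ {n} k j → k + j ≡ n → binomial n k ≡ binomial n j
binomial-sym k j = ∑-∁ k j (const 1)

-- The LYM inequality, cleared of denominators.
level-density : ∀ {A : SetFamily n} → UpClosed A → ∀ i d r → d + i + r ≡ n →
                level i A * binomial n (d + i) ≤ level (d + i) A * binomial n i
level-density up i zero r e = ≤-refl
level-density {n} {A} up i (suc d) r e = *-cancelʳ-≤ _ _ (suc j) (begin
  aᵢ * binomial n (suc j) * suc j     ≡⟨ *-assoc aᵢ _ _ ⟩
  aᵢ * (binomial n (suc j) * suc j)   ≡⟨ cong (aᵢ *_) (binomial-step j (suc r) e′) ⟩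
  aᵢ * (binomial n j * suc r)         ≡⟨ *-assoc aᵢ _ _ ⟨
  aᵢ * binomial n j * suc r           ≤⟨ *-monoˡ-≤ (suc r) (level-density up i d (suc r) e′) ⟩
  level j A * binomial n i * suc r    ≡⟨ rotate (level j A) (binomial n i) (suc r) ⟩
  level j A * suc r * binomial n i    ≤⟨ *-monoˡ-≤ (binomial n i) (level-step up j (suc r) e′) ⟩
  level (suc j) A * suc j * binomial n i ≡⟨ rotate (level (suc j) A) (suc j) (binomial n i) ⟩
  level (suc j) A * binomial n i * suc j ∎)
  where
  open ≤-Reasoning
  j aᵢ : ℕ
  j = d + i
  aᵢ = level i A
  e′ : j + suc r ≡ n
  e′ = trans (+-suc j r) e
  rotate : ∀ a b c → a * b * c ≡ a * c * b
  rotate = solve-∀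

-- Unlike <, this is available for empty families, so it can be summed along the induction below.
infix 4 _≺_
_≺_ : ℕ → ℕ → Set
a ≺ b = a < b ⊎ a ≡ 0

≺⇒≤ : ∀ {a b} → a ≺ b → a ≤ b
≺⇒≤ (inj₁ a<b) = <⇒≤ a<b
≺⇒≤ (inj₂ refl) = z≤n

≺-+ : ∀ {a b c d} → a ≺ b → c ≺ d → a + c ≺ b + d
≺-+ (inj₁ a<b)  c≺d         = inj₁ (+-mono-<-≤ a<b (≺⇒≤ c≺d))
≺-+ (inj₂ refl) (inj₂ refl) = inj₂ refl
≺-+ {b = b} (inj₂ refl) (inj₁ c<d) = inj₁ (≤-trans c<d (m≤n+m _ b))

lastᵇ : Subset (suc n) → Bool
lastᵇ {n} X = lookup X (fromℕ n)

lastᵇ-∷ʳ : ∀ (X : Subset n) b → lastᵇ (X ∷ʳ b) ≡ b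
lastᵇ-∷ʳ []      b = refl
lastᵇ-∷ʳ (_ ∷ X) b = lastᵇ-∷ʳ X b

withLast : SetFamily (suc n) → SetFamily (suc n)
withLast A X = A X ∧ lastᵇ X

level-withLast : ∀ k (A : SetFamily (suc n)) → level (suc k) (withLast A) ≡ level k (A ∘ (_∷ʳ true))
level-withLast k A = trans (∑-∷ʳ-suc k (⟦_⟧ ∘ withLast A)) (cong₂ _+_
  (level-empty (suc k) (λ X _ → trans (cong (A (X ∷ʳ false) ∧_) (lastᵇ-∷ʳ X false)) (Boolₚ.∧-zeroʳ _)))
  (level-cong k (λ X → trans (cong (A (X ∷ʳ true) ∧_) (lastᵇ-∷ʳ X true)) (Boolₚ.∧-identityʳ _))))

-- Both sides are multiples of `binomial L s`: the left one by (L+1)/(M+1), the right one by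
-- M/(s+1). Clearing denominators leaves exactly the hypothesis.
binomial-ratio : ∀ s M → (M + s + 1) * (s + 1) < M * (M + 1) →
                 binomial (suc (M + s)) s < binomial (M + s) (suc s)
binomial-ratio s M h = *-cancelʳ-< ((M + 1) * (s + 1)) _ _ (begin-strict
  binomial (suc L) s * ((M + 1) * (s + 1))    ≡⟨ *-assoc (binomial (suc L) s) _ _ ⟨
  binomial (suc L) s * (M + 1) * (s + 1)      ≡⟨ cong (_* (s + 1)) (absorb s refl) ⟩
  binomial L s * (L + 1) * (s + 1)            ≡⟨ *-assoc (binomial L s) _ _ ⟩
  binomial L s * ((L + 1) * (s + 1))          <⟨ scale (binomial L s) (binomial-pos s (m≤n+m s M)) h ⟩
  binomial L s * (M * (M + 1))                ≡⟨ *-assoc (binomial L s) _ _ ⟨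
  binomial L s * M * (M + 1)                  ≡⟨ cong (_* (M + 1)) (binomial-step s M (+-comm s M)) ⟨
  binomial L (suc s) * suc s * (M + 1)        ≡⟨ regroup (binomial L (suc s)) s M ⟩
  binomial L (suc s) * ((M + 1) * (s + 1))    ∎)
  where
  open ≤-Reasoning
  L : ℕ
  L = M + s
  scale : ∀ b → 0 < b → ∀ {x y} → x < y → b * x < b * y
  scale (suc b) _ = *-monoʳ-< (suc b)
  regroup : ∀ b s M → b * suc s * (M + 1) ≡ b * ((M + 1) * (s + 1))
  regroup = solve-∀
  absorb : ∀ t → t ≡ s → binomial (suc L) t * (M + 1) ≡ binomial L t * (L + 1)
  absorb zero refl = cong (binomial L 0 *_) (cong (_+ 1) (sym (+-identityʳ M)))
  absorb (suc t) refl =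
    trans (*-distribʳ-+ (M + 1) b (binomial L t))
    (trans (cong (b * (M + 1) +_) (trans (cong (binomial L t *_) (+-comm M 1))
             (sym (binomial-step t (suc M) (lem t M)))))
    (comb b M t))
    where
    b : ℕ
    b = binomial L (suc t)
    lem : ∀ t M → t + suc M ≡ M + suc t
    lem = solve-∀
    comb : ∀ b M t → b * (M + 1) + b * suc t ≡ b * (M + suc t + 1)
    comb = solve-∀

ratio⇒< : ∀ s M → (M + s + 1) * (s + 1) < M * (M + 1) → s < M
ratio⇒< s M h = ≰⇒> λ M≤s → ≤⇒≯ (begin
  M * (M + 1) ≤⟨ *-mono-≤ (≤-trans (m≤m+n M s) (m≤m+n _ 1)) (+-monoˡ-≤ 1 M≤s) ⟩
  (M + s + 1) * (s + 1) ∎) h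
  where open ≤-Reasoning

-- Let `Q` be the link of the last point. Members avoiding the last point also lie in `Q` by
-- up-closure, so level `s` of `G` is bounded by levels s and s-1 of `Q`. LYM compares their
-- densities with that of level M-1 of `Q`, which counts `withLast G`. Pascal's rule adds the two
-- bounds up to C(M+s+1, s), against C(M+s, s+1) on the other side.
level≺withLast : ∀ s M (G : SetFamily (suc (M + s))) → UpClosed G →
                 (M + s + 1) * (s + 1) < M * (M + 1) → level s G ≺ level M (withLast G)
level≺withLast s zero    G up h = contradiction h λ ()
level≺withLast s (suc M) G up h = subst (level s G ≺_) (sym (level-withLast M G)) (decide (m≤n⇒m<n∨m≡n z≤n))
  where
  open ≤-Reasoning
  L d : ℕ
  L = suc M + s
  d = M ∸ s
  Q : SetFamily L
  Q = G ∘ (_∷ʳ true)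
  q : ℕ
  q = level M Q
  s≤M : s ≤ M
  s≤M = s≤s⁻¹ (ratio⇒< s (suc M) h)
  upQ : UpClosed Q
  upQ X⊑Y = up (⊑-∷ʳ X⊑Y b≤b)
  density : ∀ i → i ≤ M → level i Q * binomial L M ≤ q * binomial L i
  density i i≤M = subst (λ j → level i Q * binomial L j ≤ level j Q * binomial L i) (m∸n+n≡m i≤M)
    (level-density upQ i (M ∸ i) (suc s) (trans (cong (_+ suc s) (m∸n+n≡m i≤M)) (+-suc M s)))
  restrict : ∀ i → level i (G ∘ (_∷ʳ false)) ≤ level i Q
  restrict i = level-mono i {G ∘ (_∷ʳ false)} {Q} (λ X _ → up (⊑-∷ʳ ⊑-refl f≤t))
  main : level s G * binomial L M ≤ q * binomial (suc L) s
  main = go s s≤M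
    where
    go : ∀ s → s ≤ M → level s G * binomial L M ≤ q * binomial (suc L) s
    go zero s≤M = begin
      level 0 G * binomial L M ≡⟨ cong (_* binomial L M) (∑-∷ʳ-zero (⟦_⟧ ∘ G)) ⟩
      level 0 (G ∘ (_∷ʳ false)) * binomial L M ≤⟨ *-monoˡ-≤ (binomial L M) (restrict 0) ⟩
      level 0 Q * binomial L M ≤⟨ density 0 s≤M ⟩
      q * binomial L 0 ∎
    go (suc s) s≤M = begin
      level (suc s) G * binomial L M ≡⟨ cong (_* binomial L M) (∑-∷ʳ-suc s (⟦_⟧ ∘ G)) ⟩
      (level (suc s) (G ∘ (_∷ʳ false)) + level s Q) * binomial L M
        ≤⟨ *-monoˡ-≤ (binomial L M) (+-monoˡ-≤ (level s Q) (restrict (suc s))) ⟩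
      (level (suc s) Q + level s Q) * binomial L M ≡⟨ *-distribʳ-+ (binomial L M) (level (suc s) Q) _ ⟩
      level (suc s) Q * binomial L M + level s Q * binomial L M
        ≤⟨ +-mono-≤ (density (suc s) s≤M) (density s (≤-trans (n≤1+n s) s≤M)) ⟩
      q * binomial L (suc s) + q * binomial L s ≡⟨ *-distribˡ-+ q (binomial L (suc s)) _ ⟨
      q * binomial (suc L) (suc s) ∎
  ratio : binomial (suc L) s < binomial L M
  ratio = <-≤-trans (binomial-ratio s (suc M) h) (≤-reflexive (binomial-sym (suc s) M (cong suc (+-comm s M))))
  decide : 0 < q ⊎ 0 ≡ q → level s G ≺ q
  decide (inj₂ 0≡q) = inj₂ (n≤0⇒n≡0 (*-cancelʳ-≤ (level s G) 0 (binomial L M)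
                        {{>-nonZero (≤-<-trans z≤n ratio)}}
                        (≤-trans main (≤-reflexive (cong (_* binomial (suc L) s) (sym 0≡q))))))
  decide (inj₁ 0<q) = inj₁ (≰⇒> λ q≤g → ≤⇒≯ (begin
      q * binomial L M         ≤⟨ *-monoˡ-≤ (binomial L M) q≤g ⟩
      level s G * binomial L M ≤⟨ main ⟩
      q * binomial (suc L) s   ∎) (*-monoʳ-< q {{>-nonZero 0<q}} ratio))

-- Shifted intersecting families

infix 4 _↝_
data _↝_ : Subset n → Subset n → Set where
  here  : ∀ {X : Subset n} → false ∷ true ∷ X ↝ true ∷ false ∷ X
  there : ∀ {X Y : Subset n} {b} → X ↝ Y → b ∷ X ↝ b ∷ Y

LeftShifted : SetFamily n → Set
LeftShifted A = ∀ {X Y} → X ↝ Y → A X ≡ true → A Y ≡ true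

_-Intersecting_ : ℕ → SetFamily n → Set
t -Intersecting A = ∀ {X Y} → A X ≡ true → A Y ≡ true → t ≤ ∣ X ∩ˢ Y ∣

-- `X′` is `X` without the first point it shares with `Y`; left steps carry this point to the free
-- front place.
pull-to-front : ∀ (X Y : Subset n) → 1 ≤ ∣ X ∩ˢ Y ∣ →
  Σ[ X′ ∈ Subset n ] (∣ X ∩ˢ Y ∣ ≡ suc ∣ X′ ∩ˢ Y ∣
    × (∀ {A} → LeftShifted A → A (false ∷ X) ≡ true → A (true ∷ X′) ≡ true))
pull-to-front [] [] ()
pull-to-front (true ∷ X) (true ∷ Y) _ = false ∷ X , refl , λ sh → sh here
-- Adjacent steps cannot jump over a point of `X`. So that point itself moves to the front, and the
-- common point later fills the hole it leaves.
pull-to-front (true ∷ X) (false ∷ Y) p with pull-to-front X Y p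
... | X′ , e , f = true ∷ X′ , e , λ sh AX → f (sh ∘ there) (sh here AX)
pull-to-front (false ∷ X) (b ∷ Y) p with pull-to-front X Y p
... | X′ , e , f = false ∷ X′ , e , λ sh AX → sh here (f (sh ∘ there) AX)

intersecting-true∷ : ∀ {t} {A : SetFamily (suc n)} → suc t -Intersecting A → t -Intersecting (A ∘ (true ∷_))
intersecting-true∷ int AX AY = ≤-pred (int AX AY)

-- Two members missing the first point meet in an extra point: otherwise shift one of
-- their common points to the first one.
intersecting-false∷ : ∀ {t} {A : SetFamily (suc n)} → LeftShifted A →
                      suc t -Intersecting A → suc (suc t) -Intersecting (A ∘ (false ∷_))
intersecting-false∷ {t = t} sh int {X} {Y} AX AY with pull-to-front X Y (≤-trans (s≤s z≤n) (int AX AY))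
... | X′ , e , f = ≤-trans (s≤s (int (f sh AX) AY)) (≤-reflexive (sym e))

∣X∩X∣≤∣X∣ : ∀ (X : Subset n) → ∣ X ∩ˢ X ∣ ≤ ∣ X ∣
∣X∩X∣≤∣X∣ []          = z≤n
∣X∩X∣≤∣X∣ (false ∷ X) = ∣X∩X∣≤∣X∣ X
∣X∩X∣≤∣X∣ (true ∷ X)  = s≤s (∣X∩X∣≤∣X∣ X)

intersecting⇒level≡0 : ∀ {t k} {A : SetFamily n} → t -Intersecting A → k < t → level k A ≡ 0
intersecting⇒level≡0 {t = t} {k} {A} int k<t = level-empty k empty
  where
  empty : ∀ X → ∣ X ∣ ≡ k → A X ≡ false
  empty X refl with A X in AX
  ... | false = refl
  ... | true  = contradiction (≤-trans (int AX AX) (∣X∩X∣≤∣X∣ X)) (<⇒≱ k<t)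

-- M > (1+√5)/2 · k, stated without irrationals; for M = m - 1 it is the hypothesis of the theorem.
Golden : ℕ → ℕ → Set
Golden k M = k * M + k * k < M * M

golden⇒< : ∀ {k M} → Golden k M → k < M
golden⇒< {k} {M} g = ≰⇒> λ M≤k → ≤⇒≯ (≤-trans (*-monoˡ-≤ M M≤k) (m≤m+n (k * M) _)) g

-- `M + c` above φ(s + c) puts `M` above φs + (φ - 1)c, and from `c = 2` on the surplus covers the
-- lower-order terms. For `M ≥ 2s + 2` the claim holds outright; in the other case `c * M` can be
-- bounded by `c * (2 * s + 1)`.
golden⇒ratio : ∀ s M c → 2 ≤ c → Golden (s + c) (M + c) → (M + s + 1) * (s + 1) < M * (M + 1)
golden⇒ratio s M (suc (suc e)) (s≤s (s≤s z≤n)) g with M ≤? 2 * s + 1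
... | no M≰2s+1 = large (M ∸ (2 * s + 2)) (sym (m+[n∸m]≡n (≤-trans (≤-reflexive (+-suc (2 * s) 1)) (≰⇒> M≰2s+1))))
  where
  poly : ∀ s r → (2 * s + 2 + r) * (2 * s + 2 + r + 1)
               ≡ suc ((2 * s + 2 + r + s + 1) * (s + 1)) + (s * s + 4 * s + 2 + 3 * s * r + 4 * r + r * r)
  poly = solve-∀
  large : ∀ r → M ≡ 2 * s + 2 + r → (M + s + 1) * (s + 1) < M * (M + 1)
  large r refl = ≤-trans (m≤m+n _ _) (≤-reflexive (sym (poly s r)))
... | yes M≤2s+1 = +-cancelʳ-< (c * M) _ _ (begin-strict
  (M + s + 1) * (s + 1) + c * M
    ≡⟨ poly₁ s M c ⟩
  s * M + s * s + (2 * s + 1) + M + c * M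
    ≤⟨ +-monoʳ-≤ (s * M + s * s + (2 * s + 1) + M) (*-monoʳ-≤ c M≤2s+1) ⟩
  s * M + s * s + (2 * s + 1) + M + c * (2 * s + 1)
    ≤⟨ m≤m+n _ _ ⟩
  -- Here `2 ≤ c` enters: for c = 2 + e, the excess of cs + c² - c over 2s + 1 is the added
  -- polynomial, which has natural coefficients.
  s * M + s * s + (2 * s + 1) + M + c * (2 * s + 1) + (1 + s * e + 3 * e + e * e)
    ≡⟨ poly₂ s M e ⟩
  s * M + s * s + 3 * c * s + c * c + M
    <⟨ +-monoˡ-< M cancelled ⟩
  M * M + c * M + M
    ≡⟨ poly₃ M c ⟩
  M * (M + 1) + c * M ∎)
  where
  open ≤-Reasoning
  c : ℕ
  c = 2 + e
  poly₁ : ∀ s M c → (M + s + 1) * (s + 1) + c * M ≡ s * M + s * s + (2 * s + 1) + M + c * M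
  poly₁ = solve-∀
  poly₂ : ∀ s M e → s * M + s * s + (2 * s + 1) + M + (2 + e) * (2 * s + 1) + (1 + s * e + 3 * e + e * e)
                  ≡ s * M + s * s + 3 * (2 + e) * s + (2 + e) * (2 + e) + M
  poly₂ = solve-∀
  poly₃ : ∀ M c → M * M + c * M + M ≡ M * (M + 1) + c * M
  poly₃ = solve-∀
  expandˡ : ∀ s M c → (s + c) * (M + c) + (s + c) * (s + c)
                    ≡ s * M + s * s + 3 * c * s + c * c + (c * M + c * c)
  expandˡ = solve-∀
  expandʳ : ∀ M c → (M + c) * (M + c) ≡ M * M + c * M + (c * M + c * c)
  expandʳ = solve-∀
  cancelled : s * M + s * s + 3 * c * s + c * c < M * M + c * M
  cancelled = +-cancelʳ-< (c * M + c * c) _ _ (subst₂ _<_ (expandˡ s M c) (expandʳ M c) g)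

-- The points are scanned from the first to the last one, with c points of the set seen so far:
-- a shifted t-intersecting family becomes (t∸1)-intersecting on the sets containing the current
-- point and (t+1)-intersecting on the others.  Once t = 0 the LYM inequality applies.
shifted-bound : ∀ L t s M c (G : SetFamily (suc L)) → UpClosed G → LeftShifted G → t -Intersecting G →
                M + s ≡ L + t → 2 ≤ c + t → Golden (s + c) (M + c) → level s G ≺ level M (withLast G)
shifted-bound L zero s M c G up sh int e 2≤c g with trans e (+-identityʳ L)
... | refl = level≺withLast s M G up (golden⇒ratio s M c (≤-trans 2≤c (≤-reflexive (+-identityʳ c))) g)
shifted-bound L (suc t) zero M c G up sh int e 2≤c g = inj₂ (intersecting⇒level≡0 {k = 0} {A = G} int (s≤s z≤n))
shifted-bound L (suc t) (suc s) zero c G up sh int e 2≤c g =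
  contradiction (golden⇒< g) (≤⇒≯ (m≤n+m c (suc s)))
-- A single point is left and the lead was never reached: the invariant makes the required
-- intersection larger than the set itself.
shifted-bound zero (suc t) (suc s) (suc M) c G up sh int e 2≤c g =
  inj₂ (intersecting⇒level≡0 {k = suc s} {A = G} int (begin
    suc (suc s)       ≤⟨ s≤s (m≤n+m (suc s) M) ⟩
    suc (M + suc s)   ≡⟨ e ⟩
    suc t             ∎))
  where open ≤-Reasoning
shifted-bound (suc L) (suc t) (suc s) (suc M) c G up sh int e 2≤c g = ≺-+
  (shifted-bound L (suc (suc t)) (suc s) (suc M) c (G ∘ (false ∷_))
    (UpClosed-∷ {A = G} false up) (sh ∘ there) (intersecting-false∷ {A = G} sh int)
    (trans e (sym (+-suc L (suc t)))) (≤-trans 2≤c (+-monoʳ-≤ c (n≤1+n (suc t)))) g)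
  (shifted-bound L t s M (suc c) (G ∘ (true ∷_))
    (UpClosed-∷ {A = G} true up) (sh ∘ there) (intersecting-true∷ {A = G} int)
    (suc-injective (trans (sym (+-suc M s)) (trans (suc-injective e) (+-suc L t))))
    (≤-trans 2≤c (≤-reflexive (+-suc c t)))
    (subst₂ Golden (sym (+-suc s c)) (sym (+-suc M c)) g))

-- The bound for one up-closed shifted family

∧-elim : ∀ {a b} → a ∧ b ≡ true → a ≡ true × b ≡ true
∧-elim {true} {true} _ = refl , refl

∧-intro : ∀ {a b} → a ≡ true → b ≡ true → a ∧ b ≡ true
∧-intro refl refl = refl

∨-elim : ∀ {a b} → a ∨ b ≡ true → a ≡ true ⊎ b ≡ true
∨-elim {true}  _ = inj₁ refl
∨-elim {false} e = inj₂ e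

∨-introˡ : ∀ {a b} → a ≡ true → a ∨ b ≡ true
∨-introˡ refl = refl

∨-introʳ : ∀ {a b} → b ≡ true → a ∨ b ≡ true
∨-introʳ {a} refl = Boolₚ.∨-zeroʳ a

∣X∩∁X∣≡0 : ∀ (X : Subset n) → ∣ X ∩ˢ ∁ X ∣ ≡ 0
∣X∩∁X∣≡0 []          = refl
∣X∩∁X∣≡0 (false ∷ X) = ∣X∩∁X∣≡0 X
∣X∩∁X∣≡0 (true ∷ X)  = ∣X∩∁X∣≡0 X

only : Fin n → Fin n → SetFamily n
only x y X = lookup X x ∧ not (lookup X y)

notBoth : Fin n → Fin n → SetFamily n → SetFamily n
notBoth x y A X = A X ∧ not (lookup X x ∧ lookup X y)

Star : ℕ → Fin n → SetFamily n → Set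
Star k x A = ∀ X → ∣ X ∣ ≡ k → A X ≡ true → lookup X x ≡ true

-- Strictness or a star, stated for each family separately: equality in the sum of two such bounds
-- then makes both families stars.
StarOr< : ℕ → Fin n → Fin n → SetFamily n → Set
StarOr< k x y A = level k (notBoth x y A) < level k (only x y)
                ⊎ (level k (notBoth x y A) ≤ level k (only x y) × Star k x A)

module _ {N κ M : ℕ} (M+κ : M + suc κ ≡ suc (suc N)) (golden : Golden (suc κ) M) where

  private
    first last : Fin (suc (suc N))
    first = zero
    last  = fromℕ (suc N)

  -- For `X` avoiding the last point, `true ∷ X` and `false ∷ ∁ X` are disjoint, so at most one is a
  -- member. The members through the first but not the last point thus leave room for `ℓ` further
  -- k-sets of that kind, and by `shifted-bound` the members missing the first point fit into it.
  -- The sets `false ∷ ∁ X` have `M` points, which is why `A` is up-closed here and not uniform.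
  upClosed-bound : ∀ (A : SetFamily (suc (suc N))) → UpClosed A → LeftShifted A → 1 -Intersecting A →
    StarOr< (suc κ) first last A
  upClosed-bound A up sh int = result (shifted-bound N 2 (suc κ) M 0 A₀ (UpClosed-∷ {A = A} false up) (sh ∘ there)
                                (intersecting-false∷ {A = A} sh int)
                                (trans M+κ (+-comm 2 N)) ≤-refl
                                (subst₂ Golden (sym (+-identityʳ (suc κ))) (sym (+-identityʳ M)) golden))
    where
    A₀ : SetFamily (suc N)
    A₀ = A ∘ (false ∷_)
    ℓ p T a : ℕ
    ℓ = level M (withLast A₀)
    p = level κ (λ X → A (true ∷ X) ∧ not (lastᵇ X))
    T = level κ (not ∘ lastᵇ)
    a = level (suc κ) A₀
    pointwise : ∀ X → ⟦ withLast A₀ (∁ X) ⟧ + ⟦ A (true ∷ X) ∧ not (lastᵇ X) ⟧ ≤ ⟦ not (lastᵇ X) ⟧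
    pointwise X rewrite lookup-map (fromℕ N) not X with lastᵇ X | A (false ∷ ∁ X) in A₀X | A (true ∷ X) in A₁X
    ... | true  | true  | true  = z≤n
    ... | true  | true  | false = z≤n
    ... | true  | false | true  = z≤n
    ... | true  | false | false = z≤n
    ... | false | false | true  = s≤s z≤n
    ... | false | false | false = z≤n
    ... | false | true  | false = s≤s z≤n
    ... | false | true  | true  = contradiction (int A₁X A₀X) (<⇒≱ (s≤s (≤-reflexive (∣X∩∁X∣≡0 X))))
    κ+M : κ + M ≡ suc N
    κ+M = suc-injective (trans (+-comm (suc κ) M) M+κ)
    ℓ+p≤T : ℓ + p ≤ T
    ℓ+p≤T = ≤-trans (≤-reflexive (trans (cong (_+ p) (sym (∑-∁ κ M (⟦_⟧ ∘ withLast A₀) κ+M)))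
                      (sym (∑-+ κ (⟦_⟧ ∘ withLast A₀ ∘ ∁) (λ X → ⟦ A (true ∷ X) ∧ not (lastᵇ X) ⟧)))))
                    (∑-mono κ (λ X _ → pointwise X))
    split : level (suc κ) (notBoth first last A) ≡ a + p
    split = cong (_+ p) (level-cong (suc κ) (λ X → Boolₚ.∧-identityʳ (A₀ X)))
    target : T ≤ level (suc κ) (only first last)
    target = m≤n+m T _
    result : a ≺ ℓ → StarOr< (suc κ) first last A
    result (inj₁ a<ℓ) = inj₁ (subst (_< level (suc κ) (only first last)) (sym split) (≤-trans (+-monoˡ-< p a<ℓ) (≤-trans ℓ+p≤T target)))
    result (inj₂ a≡0) = inj₂ (≤-trans (≤-reflexive split)
                                (≤-trans (+-monoˡ-≤ p (≤-trans (≤-reflexive a≡0) z≤n)) (≤-trans ℓ+p≤T target)) , star)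
      where
      star : Star (suc κ) first A
      star (true ∷ X)  e AX = refl
      star (false ∷ X) e AX = contradiction (trans (sym AX) (level≡0⇒empty (suc κ) {A₀} a≡0 X e)) λ ()

-- Passing to the up-closure

Uniform : ℕ → SetFamily n → Set
Uniform k A = ∀ {X} → A X ≡ true → ∣ X ∣ ≡ k

does-true : ∀ {P : Set} (P? : Dec P) → does P? ≡ true → P
does-true (yes p) _ = p

below? : ∀ (A : SetFamily n) X → Dec (∃[ Y ] (A Y ≡ true × Y ⊑ X))
below? A X = anySubset? (λ Y → (A Y Bool.≟ true) ×-dec Pointwise.decidable Boolₚ._≤?_ Y X)

upClosure : SetFamily n → SetFamily n
upClosure A X = does (below? A X)

⊆upClosure : ∀ {A : SetFamily n} {X} → A X ≡ true → upClosure A X ≡ true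
⊆upClosure {A = A} {X} AX = dec-true (below? A X) (X , AX , ⊑-refl)

upClosure-UpClosed : (A : SetFamily n) → UpClosed (upClosure A)
upClosure-UpClosed A {X} {Y} X⊑Y p with does-true (below? A X) p
... | Z , AZ , Z⊑X = dec-true (below? A Y) (Z , AZ , Pointwise.trans Boolₚ.≤-trans Z⊑X X⊑Y)

∣∩∣-mono : ∀ {X X′ Y Y′ : Subset n} → X ⊑ X′ → Y ⊑ Y′ → ∣ X ∩ˢ Y ∣ ≤ ∣ X′ ∩ˢ Y′ ∣
∣∩∣-mono []         []         = z≤n
∣∩∣-mono {X = false ∷ _} {true ∷ _} {_} {true ∷ _} (f≤t ∷ p) (f≤t ∷ q) = m≤n⇒m≤1+n (∣∩∣-mono p q)
∣∩∣-mono {X = false ∷ _} {true ∷ _} {true ∷ _} {true ∷ _} (f≤t ∷ p) (b≤b ∷ q) = m≤n⇒m≤1+n (∣∩∣-mono p q)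
∣∩∣-mono {X = false ∷ _} {true ∷ _} {false ∷ _} {false ∷ _} (f≤t ∷ p) (b≤b ∷ q) = ∣∩∣-mono p q
∣∩∣-mono {X = true ∷ _} {true ∷ _} {_} {true ∷ _} (b≤b ∷ p) (f≤t ∷ q) = m≤n⇒m≤1+n (∣∩∣-mono p q)
∣∩∣-mono {X = false ∷ _} {false ∷ _} {_} {true ∷ _} (b≤b ∷ p) (f≤t ∷ q) = ∣∩∣-mono p q
∣∩∣-mono {X = false ∷ _} {false ∷ _} (b≤b ∷ p) (b≤b ∷ q) = ∣∩∣-mono p q
∣∩∣-mono {X = true ∷ _} {true ∷ _} {true ∷ _} (b≤b ∷ p) (b≤b ∷ q) = s≤s (∣∩∣-mono p q)
∣∩∣-mono {X = true ∷ _} {true ∷ _} {false ∷ _} (b≤b ∷ p) (b≤b ∷ q) = ∣∩∣-mono p q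

upClosure-intersecting : ∀ {t} {A : SetFamily n} → t -Intersecting A → t -Intersecting upClosure A
upClosure-intersecting {A = A} int {X} {Y} p q with does-true (below? A X) p | does-true (below? A Y) q
... | X₀ , AX₀ , X₀⊑X | Y₀ , AY₀ , Y₀⊑Y = ≤-trans (int AX₀ AY₀) (∣∩∣-mono X₀⊑X Y₀⊑Y)

-- If `Y` contains the moving point it can make the same move; otherwise it still lies below `X′`.
⊑-↝ : ∀ {Y X X′ : Subset n} → Y ⊑ X → X ↝ X′ → Y ⊑ X′ ⊎ ∃[ Y′ ] (Y ↝ Y′ × Y′ ⊑ X′)
⊑-↝ (b≤b ∷ b≤b ∷ p) here = inj₂ (_ , here , b≤b ∷ b≤b ∷ p)
⊑-↝ (b≤b ∷ f≤t ∷ p) here = inj₁ (f≤t ∷ b≤b ∷ p)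
⊑-↝ (a ∷ p) (there s) with ⊑-↝ p s
... | inj₁ Y⊑X′            = inj₁ (a ∷ Y⊑X′)
... | inj₂ (_ , s′ , Y′⊑X′) = inj₂ (_ , there s′ , a ∷ Y′⊑X′)

upClosure-leftShifted : ∀ {A : SetFamily n} → LeftShifted A → LeftShifted (upClosure A)
upClosure-leftShifted {A = A} sh {X} {X′} s p with does-true (below? A X) p
... | Y , AY , Y⊑X with ⊑-↝ Y⊑X s
... | inj₁ Y⊑X′             = dec-true (below? A X′) (Y , AY , Y⊑X′)
... | inj₂ (Y′ , s′ , Y′⊑X′) = dec-true (below? A X′) (Y′ , sh s′ AY , Y′⊑X′)

-- Reversing the ground set, and the bound for a pair of families

RightShifted : SetFamily n → Set
RightShifted A = ∀ {X Y} → X ↝ Y → A Y ≡ true → A X ≡ true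

↝-∷ʳ : ∀ {X Y : Subset n} {b} → X ↝ Y → X ∷ʳ b ↝ Y ∷ʳ b
↝-∷ʳ here      = here
↝-∷ʳ (there s) = there (↝-∷ʳ s)

↝-end : ∀ (X : Subset n) → X ∷ʳ false ∷ʳ true ↝ X ∷ʳ true ∷ʳ false
↝-end []      = here
↝-end (_ ∷ X) = there (↝-end X)

↝-reverse : ∀ {X Y : Subset n} → X ↝ Y → reverse Y ↝ reverse X
↝-reverse (here {X = X})
  rewrite reverse-∷ true (false ∷ X) | reverse-∷ false X
        | reverse-∷ false (true ∷ X) | reverse-∷ true X = ↝-end (reverse X)
↝-reverse (there {X = X} {Y} {b} s)
  rewrite reverse-∷ b X | reverse-∷ b Y = ↝-∷ʳ (↝-reverse s)

∩-∷ʳ : ∀ (X Y : Subset n) a b → (X ∷ʳ a) ∩ˢ (Y ∷ʳ b) ≡ (X ∩ˢ Y) ∷ʳ (a ∧ b)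
∩-∷ʳ []      []      a b = refl
∩-∷ʳ (x ∷ X) (y ∷ Y) a b = cong ((x ∧ y) ∷_) (∩-∷ʳ X Y a b)

∩-reverse : ∀ (X Y : Subset n) → reverse X ∩ˢ reverse Y ≡ reverse (X ∩ˢ Y)
∩-reverse []      []      = refl
∩-reverse (x ∷ X) (y ∷ Y) rewrite reverse-∷ x X | reverse-∷ y Y | reverse-∷ (x ∧ y) (X ∩ˢ Y) =
  trans (∩-∷ʳ (reverse X) (reverse Y) x y) (cong (_∷ʳ (x ∧ y)) (∩-reverse X Y))

∣∷ʳ∣ : ∀ (X : Subset n) b → ∣ X ∷ʳ b ∣ ≡ ∣ b ∷ X ∣
∣∷ʳ∣ []          b     = refl
∣∷ʳ∣ (false ∷ X) false = ∣∷ʳ∣ X false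
∣∷ʳ∣ (false ∷ X) true  = ∣∷ʳ∣ X true
∣∷ʳ∣ (true ∷ X)  false = cong suc (∣∷ʳ∣ X false)
∣∷ʳ∣ (true ∷ X)  true  = cong suc (∣∷ʳ∣ X true)

∣reverse∣ : ∀ (X : Subset n) → ∣ reverse X ∣ ≡ ∣ X ∣
∣reverse∣ []      = refl
∣reverse∣ (false ∷ X) rewrite reverse-∷ false X = trans (∣∷ʳ∣ (reverse X) false) (∣reverse∣ X)
∣reverse∣ (true ∷ X) rewrite reverse-∷ true X = trans (∣∷ʳ∣ (reverse X) true) (cong suc (∣reverse∣ X))

lastᵇ-reverse : ∀ (X : Subset (suc n)) → lastᵇ (reverse X) ≡ lookup X zero
lastᵇ-reverse (x ∷ X) rewrite reverse-∷ x X = lastᵇ-∷ʳ (reverse X) x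

first-reverse : ∀ (X : Subset (suc n)) → lookup (reverse X) zero ≡ lastᵇ X
first-reverse X = trans (sym (lastᵇ-reverse (reverse X))) (cong lastᵇ (reverse-involutive X))

star₂ : Fin n → Fin n → SetFamily n
star₂ x y X = lookup X x ∨ lookup X y

notBoth-reverse : ∀ k {x y : Fin n} → (∀ X → lookup (reverse X) x ≡ lookup X y) → (∀ X → lookup (reverse X) y ≡ lookup X x) →
                  ∀ B → level k (notBoth x y (B ∘ reverse)) ≡ level k (notBoth x y B)
notBoth-reverse k {x} {y} rx ry B = trans
  (level-cong k {notBoth x y (B ∘ reverse)} {notBoth x y B ∘ reverse} λ X → cong (λ b → B (reverse X) ∧ not b)
    (trans (Boolₚ.∧-comm (lookup X x) (lookup X y)) (sym (cong₂ _∧_ (rx X) (ry X)))))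
  (∑-reverse k (⟦_⟧ ∘ notBoth x y B))

only-reverse : ∀ k {x y : Fin n} → (∀ X → lookup (reverse X) x ≡ lookup X y) → (∀ X → lookup (reverse X) y ≡ lookup X x) →
               level k (only x y) ≡ level k (only y x)
only-reverse k {x} {y} rx ry = trans
  (level-cong k {only x y} {only y x ∘ reverse} (λ X → sym (cong₂ (λ a b → a ∧ not b) (ry X) (rx X))))
  (∑-reverse k (⟦_⟧ ∘ only y x))

notBoth-comm : ∀ k (x y : Fin n) B → level k (notBoth x y B) ≡ level k (notBoth y x B)
notBoth-comm k x y B = level-cong k {notBoth x y B} {notBoth y x B}
  (λ X → cong (λ b → B X ∧ not b) (Boolₚ.∧-comm (lookup X x) (lookup X y)))

notBoth-mono : ∀ k {x y : Fin n} {A B : SetFamily n} → (∀ X → A X ≡ true → B X ≡ true) →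
               level k (notBoth x y A) ≤ level k (notBoth x y B)
notBoth-mono k {x} {y} {A} {B} h = level-mono k {notBoth x y A} {notBoth x y B}
  (λ X _ p → ∧-intro (h X (proj₁ (∧-elim p))) (proj₂ (∧-elim {A X} p)))

module _ {N κ M : ℕ} (M+κ : M + suc κ ≡ suc (suc N)) (golden : Golden (suc κ) M) where

  private
    first last : Fin (suc (suc N))
    first = zero
    last  = fromℕ (suc N)

  leftShifted-bound : ∀ (A : SetFamily (suc (suc N))) → LeftShifted A → 1 -Intersecting A →
    StarOr< (suc κ) first last A
  leftShifted-bound A sh int = restrict
    (upClosed-bound {κ = κ} M+κ golden (upClosure A) (upClosure-UpClosed A)
      (upClosure-leftShifted {A = A} sh) (upClosure-intersecting {A = A} int))
    where
    k : ℕ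
    k = suc κ
    grow : level k (notBoth first last A) ≤ level k (notBoth first last (upClosure A))
    grow = notBoth-mono k {first} {last} {A} {upClosure A} (λ X → ⊆upClosure {A = A})
    restrict : StarOr< k first last (upClosure A) → StarOr< k first last A
    restrict (inj₁ lt)        = inj₁ (≤-<-trans grow lt)
    restrict (inj₂ (le , st)) = inj₂ (≤-trans grow le , λ X e AX → st X e (⊆upClosure {A = A} AX))

  rightShifted-bound : ∀ (B : SetFamily (suc (suc N))) → RightShifted B → 1 -Intersecting B →
    StarOr< (suc κ) last first B
  rightShifted-bound B sh int = transport (leftShifted-bound (B ∘ reverse) (sh ∘ ↝-reverse)
        (λ {X} {Y} BX BY → ≤-trans (int BX BY) (≤-reflexive (trans (cong ∣_∣ (∩-reverse X Y)) (∣reverse∣ (X ∩ˢ Y))))))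
    where
    k : ℕ
    k = suc κ
    e₁ : level k (notBoth first last (B ∘ reverse)) ≡ level k (notBoth last first B)
    e₁ = trans (notBoth-reverse k {first} {last} first-reverse lastᵇ-reverse B) (notBoth-comm k first last B)
    e₂ : level k (only first last) ≡ level k (only last first)
    e₂ = only-reverse k {first} {last} first-reverse lastᵇ-reverse
    star : Star k first (B ∘ reverse) → Star k last B
    star st X e BX = trans (sym (first-reverse X))
      (st (reverse X) (trans (∣reverse∣ X) e) (trans (cong B (reverse-involutive X)) BX))
    transport : StarOr< k first last (B ∘ reverse) → StarOr< k last first B
    transport (inj₁ lt)        = inj₁ (subst₂ _<_ e₁ e₂ lt)
    transport (inj₂ (le , st)) = inj₂ (subst₂ _≤_ e₁ e₂ le , star st)

-- All k-sets through both `x` and `y` are granted to the union at once; the remaining members are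
-- counted in `A` and in `B` separately. `star₂ x y` splits in the same way, so strictness in either
-- family makes the whole estimate strict.
∪-bound : ∀ k {x y : Fin n} {A B : SetFamily n} → StarOr< k x y A → StarOr< k y x B →
  level k (A ∪ᶠ B) ≤ level k (star₂ x y) × (level k (star₂ x y) ≤ level k (A ∪ᶠ B) → Star k x A × Star k y B)
∪-bound {n} k {x} {y} {A} {B} = combine
  where
  both a b t u : ℕ
  both = level k (λ X → lookup X x ∧ lookup X y)
  a = level k (notBoth x y A)
  b = level k (notBoth y x B)
  t = level k (only x y)
  u = level k (only y x)
  sum₃ : ∀ (F G H : SetFamily n) → ∑ k (λ X → ⟦ F X ⟧ + (⟦ G X ⟧ + ⟦ H X ⟧)) ≡ level k F + (level k G + level k H)
  sum₃ F G H = trans (∑-+ k (⟦_⟧ ∘ F) _) (cong (level k F +_) (∑-+ k (⟦_⟧ ∘ G) (⟦_⟧ ∘ H)))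
  cover : ∀ a b p q → ⟦ a ∨ b ⟧ ≤ ⟦ p ∧ q ⟧ + (⟦ a ∧ not (p ∧ q) ⟧ + ⟦ b ∧ not (q ∧ p) ⟧)
  cover a     b     true  true  = ≤-trans (⟦⟧-mono {a ∨ b} {true} (λ _ → refl)) (s≤s z≤n)
  cover false false true  false = z≤n
  cover false true  true  false = s≤s z≤n
  cover true  b     true  false = s≤s z≤n
  cover false false false q     = z≤n
  cover true  b     false q     = s≤s z≤n
  cover false true  false true  = s≤s z≤n
  cover false true  false false = s≤s z≤n
  partition : ∀ p q → ⟦ p ∧ q ⟧ + (⟦ p ∧ not q ⟧ + ⟦ q ∧ not p ⟧) ≡ ⟦ p ∨ q ⟧
  partition true  true  = refl
  partition true  false = refl
  partition false true  = refl
  partition false false = refl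
  upper : level k (A ∪ᶠ B) ≤ both + (a + b)
  upper = ≤-trans (∑-mono k (λ X _ → cover (A X) (B X) (lookup X x) (lookup X y)))
                  (≤-reflexive (sum₃ (λ X → lookup X x ∧ lookup X y) (notBoth x y A) (notBoth y x B)))
  total : both + (t + u) ≡ level k (star₂ x y)
  total = trans (sym (sum₃ (λ X → lookup X x ∧ lookup X y) (only x y) (only y x)))
                (∑-cong k (λ X _ → partition (lookup X x) (lookup X y)))
  strict : a + b < t + u → level k (A ∪ᶠ B) < level k (star₂ x y)
  strict lt = ≤-<-trans upper (<-≤-trans (+-monoʳ-< both lt) (≤-reflexive total))
  result : ∀ {P : Set} → level k (A ∪ᶠ B) < level k (star₂ x y) →
           level k (A ∪ᶠ B) ≤ level k (star₂ x y) × (level k (star₂ x y) ≤ level k (A ∪ᶠ B) → P)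
  result lt = <⇒≤ lt , λ ge → contradiction ge (<⇒≱ lt)
  combine : StarOr< k x y A → StarOr< k y x B → level k (A ∪ᶠ B) ≤ level k (star₂ x y)
            × (level k (star₂ x y) ≤ level k (A ∪ᶠ B) → Star k x A × Star k y B)
  combine (inj₁ a<t)        (inj₁ b<u)        = result (strict (+-mono-< a<t b<u))
  combine (inj₁ a<t)        (inj₂ (b≤u , _))  = result (strict (+-mono-<-≤ a<t b≤u))
  combine (inj₂ (a≤t , _))  (inj₁ b<u)        = result (strict (+-mono-≤-< a≤t b<u))
  combine (inj₂ (a≤t , sA)) (inj₂ (b≤u , sB)) =
    ≤-trans upper (≤-trans (+-monoʳ-≤ both (+-mono-≤ a≤t b≤u)) (≤-reflexive total)) , λ _ → sA , sB

-- Sizes of stars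

lookup-empty : ∀ (X : Subset n) x → ∣ X ∣ ≡ 0 → lookup X x ≡ false
lookup-empty (false ∷ X) zero    e = refl
lookup-empty (false ∷ X) (suc x) e = lookup-empty X x e

level-star : ∀ N k (x : Fin (suc N)) → level (suc k) (λ X → lookup X x) ≡ binomial N k
level-star N k zero = cong (_+ binomial N k) (level-empty {N} (suc k) {λ _ → false} (λ _ _ → refl))
level-star (suc N) zero (suc x) = trans (cong₂ _+_ (level-star N zero x) (level-empty 0 {λ X → lookup X x} (λ X e → lookup-empty X x e))) (+-identityʳ _)
level-star (suc N) (suc k) (suc x) = cong₂ _+_ (level-star N (suc k) x) (level-star N k x)

level-star₂ : ∀ N k (x y : Fin (suc (suc N))) → x ≢ y →
              level (suc k) (star₂ x y) ≡ binomial (suc N) k + binomial N k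
level-star₂ N k zero zero x≢y = contradiction refl x≢y
level-star₂ N k zero (suc y) x≢y = trans (+-comm (level (suc k) (λ X → lookup X y)) _) (cong (binomial (suc N) k +_) (level-star N k y))
level-star₂ N k (suc x) zero x≢y = trans (+-comm (level (suc k) (λ X → lookup X x ∨ false)) _)
  (cong₂ _+_ (∑-cong k (λ X _ → cong ⟦_⟧ (Boolₚ.∨-zeroʳ (lookup X x))))
             (trans (level-cong (suc k) (λ X → Boolₚ.∨-identityʳ (lookup X x))) (level-star N k x)))
level-star₂ zero k (suc zero) (suc zero) x≢y = contradiction refl x≢y
level-star₂ (suc N) zero (suc x) (suc y) x≢y =
  trans (cong₂ _+_ (level-star₂ N 0 x y (x≢y ∘ cong suc)) 
          (level-empty 0 {star₂ x y} (λ X e → cong₂ _∨_ (lookup-empty X x e) (lookup-empty X y e)))) (+-identityʳ _)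
level-star₂ (suc N) (suc k) (suc x) (suc y) x≢y =
  trans (cong₂ _+_ (level-star₂ N (suc k) x y (x≢y ∘ cong suc)) (level-star₂ N k x y (x≢y ∘ cong suc)))
        (interchange (binomial (suc N) (suc k)) _ _ _)

-- Shifting

-- All that shifting uses of the exchange of two points. The shift in the opposite direction is the
-- same construction for `transposition-sym`.
record Transposition (i j : Fin n) : Set where
  field
    τ        : Subset n → Subset n
    lookup-i : ∀ X → lookup (τ X) i ≡ lookup X j
    lookup-j : ∀ X → lookup (τ X) j ≡ lookup X i
    lookup-≢ : ∀ {x} X → x ≢ i → x ≢ j → lookup (τ X) x ≡ lookup X x
    fixes    : ∀ X → lookup X i ≡ lookup X j → τ X ≡ X
    involutive : ∀ X → τ (τ X) ≡ X
    ∣τ∣      : ∀ X → ∣ τ X ∣ ≡ ∣ X ∣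
    ∣τ∩τ∣    : ∀ X Y → ∣ τ X ∩ˢ τ Y ∣ ≡ ∣ X ∩ˢ Y ∣
    ∑-τ      : ∀ k (f : Subset n → ℕ) → ∑ k (f ∘ τ) ≡ ∑ k f

transposition-sym : ∀ {i j : Fin n} → Transposition i j → Transposition j i
transposition-sym t = record
  { τ = τ ; lookup-i = lookup-j ; lookup-j = lookup-i ; lookup-≢ = λ X p q → lookup-≢ X q p
  ; fixes = λ X e → fixes X (sym e) ; involutive = involutive ; ∣τ∣ = ∣τ∣ ; ∣τ∩τ∣ = ∣τ∩τ∣ ; ∑-τ = ∑-τ }
  where open Transposition t

swap : Fin n → Subset (suc n) → Subset (suc n)
swap zero    (a ∷ b ∷ X) = b ∷ a ∷ X
swap (suc p) (a ∷ X)     = a ∷ swap p X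

swap-involutive : ∀ (p : Fin n) X → swap p (swap p X) ≡ X
swap-involutive zero    (a ∷ b ∷ X) = refl
swap-involutive (suc p) (a ∷ X)     = cong (a ∷_) (swap-involutive p X)

∣swap∣ : ∀ (p : Fin n) X → ∣ swap p X ∣ ≡ ∣ X ∣
∣swap∣ zero    (true ∷ true ∷ X)   = refl
∣swap∣ zero    (true ∷ false ∷ X)  = refl
∣swap∣ zero    (false ∷ true ∷ X)  = refl
∣swap∣ zero    (false ∷ false ∷ X) = refl
∣swap∣ (suc p) (true ∷ X)          = cong suc (∣swap∣ p X)
∣swap∣ (suc p) (false ∷ X)         = ∣swap∣ p X

swap-∩ : ∀ (p : Fin n) X Y → swap p X ∩ˢ swap p Y ≡ swap p (X ∩ˢ Y)
swap-∩ zero    (a ∷ b ∷ X) (c ∷ d ∷ Y) = refl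
swap-∩ (suc p) (a ∷ X)     (c ∷ Y)     = cong ((a ∧ c) ∷_) (swap-∩ p X Y)

∑-swap : ∀ k (p : Fin n) (f : Subset (suc n) → ℕ) → ∑ k (f ∘ swap p) ≡ ∑ k f
∑-swap zero          zero    f = refl
∑-swap (suc zero)    zero    f = exchange (∑ 1 (f ∘ (false ∷_) ∘ (false ∷_))) _ _
  where
  exchange : ∀ a b c → (a + b) + c ≡ (a + c) + b
  exchange = solve-∀
∑-swap (suc (suc k)) zero    f = interchange (∑ (suc (suc k)) (f ∘ (false ∷_) ∘ (false ∷_))) _ _ _
∑-swap zero          (suc p) f = ∑-swap zero p (f ∘ (false ∷_))
∑-swap (suc k)       (suc p) f = cong₂ _+_ (∑-swap (suc k) p (f ∘ (false ∷_))) (∑-swap k p (f ∘ (true ∷_)))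

adjacent : (p : Fin n) → Transposition (inject₁ p) (suc p)
adjacent p = record
  { τ = swap p ; lookup-i = lookup-i p ; lookup-j = lookup-j p ; lookup-≢ = lookup-≢ p ; fixes = fixes p
  ; involutive = swap-involutive p ; ∣τ∣ = ∣swap∣ p
  ; ∣τ∩τ∣ = λ X Y → trans (cong ∣_∣ (swap-∩ p X Y)) (∣swap∣ p (X ∩ˢ Y)) ; ∑-τ = λ k → ∑-swap k p }
  where
  lookup-i : ∀ {n} (p : Fin n) X → lookup (swap p X) (inject₁ p) ≡ lookup X (suc p)
  lookup-i zero    (a ∷ b ∷ X) = refl
  lookup-i (suc p) (a ∷ X)     = lookup-i p X
  lookup-j : ∀ {n} (p : Fin n) X → lookup (swap p X) (suc p) ≡ lookup X (inject₁ p)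
  lookup-j zero    (a ∷ b ∷ X) = refl
  lookup-j (suc p) (a ∷ X)     = lookup-j p X
  lookup-≢ : ∀ {n} (p : Fin n) {x} X → x ≢ inject₁ p → x ≢ suc p → lookup (swap p X) x ≡ lookup X x
  lookup-≢ zero    {zero}        (a ∷ b ∷ X) x≢i x≢j = contradiction refl x≢i
  lookup-≢ zero    {suc zero}    (a ∷ b ∷ X) x≢i x≢j = contradiction refl x≢j
  lookup-≢ zero    {suc (suc x)} (a ∷ b ∷ X) x≢i x≢j = refl
  lookup-≢ (suc p) {zero}        (a ∷ X)     x≢i x≢j = refl
  lookup-≢ (suc p) {suc x}       (a ∷ X)     x≢i x≢j = lookup-≢ p X (x≢i ∘ cong suc) (x≢j ∘ cong suc)
  fixes : ∀ {n} (p : Fin n) X → lookup X (inject₁ p) ≡ lookup X (suc p) → swap p X ≡ X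
  fixes zero    (a ∷ b ∷ X) refl = refl
  fixes (suc p) (a ∷ X)     e    = cong (a ∷_) (fixes p X e)

2*-cancel-≤ : ∀ {a b} → a + a ≤ b + b → a ≤ b
2*-cancel-≤ h = ≮⇒≥ λ b<a → ≤⇒≯ h (+-mono-< b<a b<a)

common-point : ∀ {X Y : Subset n} x → lookup X x ≡ true → lookup Y x ≡ true → 1 ≤ ∣ X ∩ˢ Y ∣
common-point {X = true ∷ X} {true ∷ Y} zero    _ _ = s≤s z≤n
common-point {X = a ∷ X}    {b ∷ Y}    (suc x) p q = ≤-trans (common-point {X = X} {Y} x p q) (drop (a ∧ b))
  where
  drop : ∀ c → ∣ X ∩ˢ Y ∣ ≤ ∣ c ∷ (X ∩ˢ Y) ∣
  drop true  = n≤1+n _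
  drop false = ≤-refl

module Shift {i j : Fin n} (t : Transposition i j) where
  open Transposition t

  shifted : SetFamily n
  shifted = only i j

  -- The usual shift replacing j by i: if τ X = X, the second branch is just A X.
  shift : SetFamily n → SetFamily n
  shift A X = if shifted X then A X ∨ A (τ X) else A X ∧ A (τ X)

  orientation : ∀ X → shifted X ≡ true ⊎ shifted (τ X) ≡ true ⊎ lookup X i ≡ lookup X j
  orientation X rewrite lookup-i X | lookup-j X with lookup X i | lookup X j
  ... | true  | true  = inj₂ (inj₂ refl)
  ... | true  | false = inj₁ refl
  ... | false | true  = inj₂ (inj₁ refl)
  ... | false | false = inj₂ (inj₂ refl)

  -- Counting every set together with its partner doubles the sum, so two sums can be compared on
  -- the orbits of `τ` without choosing representatives.
  ∑-double : ∀ k f → ∑ k (λ X → f X + f (τ X)) ≡ ∑ k f + ∑ k f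
  ∑-double k f = trans (∑-+ k f (f ∘ τ)) (cong (∑ k f +_) (∑-τ k f))

  module _ {f g : Subset n → ℕ}
           (pair  : ∀ X → shifted X ≡ true → f X + f (τ X) ≤ g X + g (τ X))
           (fixed : ∀ X → lookup X i ≡ lookup X j → f X ≤ g X) where

    pointwise : ∀ X → f X + f (τ X) ≤ g X + g (τ X)
    pointwise X with orientation X
    ... | inj₁ sX         = pair X sX
    ... | inj₂ (inj₁ sτX) = subst₂ _≤_ (flip f) (flip g) (pair (τ X) sτX)
      where
      flip : ∀ h → h (τ X) + h (τ (τ X)) ≡ h X + h (τ X)
      flip h = trans (cong (λ Y → h (τ X) + h Y) (involutive X)) (+-comm (h (τ X)) (h X))
    ... | inj₂ (inj₂ e) rewrite fixes X e = +-mono-≤ (fixed X e) (fixed X e)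

    ∑-pairs-≤ : ∀ k → ∑ k f ≤ ∑ k g
    ∑-pairs-≤ k = 2*-cancel-≤ (subst₂ _≤_ (∑-double k f) (∑-double k g) (∑-mono k (λ X _ → pointwise X)))

    ∑-pairs-< : ∀ k X → ∣ X ∣ ≡ k → f X + f (τ X) < g X + g (τ X) → ∑ k f < ∑ k g
    ∑-pairs-< k X e lt = ≰⇒> λ g≤f → ≤⇒≯ (+-mono-≤ g≤f g≤f)
      (subst₂ _<_ (∑-double k f) (∑-double k g) (∑-mono-< k (λ Y _ → pointwise Y) X e lt))

  shift-uniform : ∀ {k A} → Uniform k A → Uniform k (shift A)
  shift-uniform {A = A} uni {X} p with shifted X
  ... | false = uni (proj₁ (∧-elim p))
  ... | true with ∨-elim {A X} p
  ...   | inj₁ AX  = uni AX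
  ...   | inj₂ AτX = trans (sym (∣τ∣ X)) (uni AτX)

  shift-cases : ∀ A X → shift A X ≡ true → (A X ≡ true × A (τ X) ≡ true)
              ⊎ (lookup X i ≡ true × (A X ≡ true ⊎ A (τ X) ≡ true))
  shift-cases A X p with shifted X in sX
  ... | false = inj₁ (∧-elim p)
  ... | true  = inj₂ (proj₁ (∧-elim sX) , ∨-elim p)

  -- A member of the shifted family either contains `i` or lies in `A` along with its partner. Two
  -- that contain `i` meet there. Otherwise the one with both versions in `A` is matched to
  -- whichever version of the other lies in `A`, and `τ` preserves intersection sizes.
  shift-intersecting : ∀ {A} → 1 -Intersecting A → 1 -Intersecting (shift A)
  shift-intersecting {A} int {X} {Y} p q with shift-cases A X p | shift-cases A Y q
  ... | inj₁ (AX , AτX) | inj₁ (AY , AτY)        = int AX AY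
  ... | inj₁ (AX , AτX) | inj₂ (_ , inj₁ AY)     = int AX AY
  ... | inj₁ (AX , AτX) | inj₂ (_ , inj₂ AτY)    = ≤-trans (int AτX AτY) (≤-reflexive (∣τ∩τ∣ X Y))
  ... | inj₂ (_ , inj₁ AX)  | inj₁ (AY , AτY)    = int AX AY
  ... | inj₂ (_ , inj₂ AτX) | inj₁ (AY , AτY)    = ≤-trans (int AτX AτY) (≤-reflexive (∣τ∩τ∣ X Y))
  ... | inj₂ (iX , _)   | inj₂ (iY , _)          = common-point {X = X} {Y} i iX iY

  shift-at : ∀ A X → shifted X ≡ true → shift A X ≡ A X ∨ A (τ X)
  shift-at A X sX rewrite sX = refl

  shift-at-τ : ∀ A X → shifted X ≡ true → shift A (τ X) ≡ A X ∧ A (τ X)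
  shift-at-τ A X sX rewrite lookup-i X | lookup-j X | involutive X with lookup X i | lookup X j
  ... | true | false = Boolₚ.∧-comm (A (τ X)) (A X)

  shift-fixed : ∀ A X → lookup X i ≡ lookup X j → shift A X ≡ A X
  shift-fixed A X e rewrite fixes X e | e with lookup X j
  ... | true  = Boolₚ.∧-idem (A X)
  ... | false = Boolₚ.∧-idem (A X)

  weigh : (Subset n → ℕ) → SetFamily n → Subset n → ℕ
  weigh v A X = ⟦ A X ⟧ * v X

  module _ {v : Subset n → ℕ} (v-dec : ∀ X → shifted X ≡ true → v X < v (τ X)) (A : SetFamily n) where

    private
      pair : ∀ X → shifted X ≡ true → weigh v (shift A) X + weigh v (shift A) (τ X) ≤ weigh v A X + weigh v A (τ X)
      pair X sX = subst₂ (λ p q → ⟦ p ⟧ * v X + ⟦ q ⟧ * v (τ X) ≤ weigh v A X + weigh v A (τ X))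
        (sym (shift-at A X sX)) (sym (shift-at-τ A X sX)) (move (A X) (A (τ X)))
        where
        move : ∀ a a′ → ⟦ a ∨ a′ ⟧ * v X + ⟦ a ∧ a′ ⟧ * v (τ X) ≤ ⟦ a ⟧ * v X + ⟦ a′ ⟧ * v (τ X)
        move true  true  = ≤-refl
        move true  false = ≤-refl
        move false true  = ≤-trans (≤-reflexive (+-identityʳ (v X + 0))) (+-monoˡ-≤ 0 (<⇒≤ (v-dec X sX)))
        move false false = z≤n

      fixed : ∀ X → lookup X i ≡ lookup X j → weigh v (shift A) X ≤ weigh v A X
      fixed X e = ≤-reflexive (cong (λ b → ⟦ b ⟧ * v X) (shift-fixed A X e))

    shift-weight-≤ : ∀ k → ∑ k (weigh v (shift A)) ≤ ∑ k (weigh v A)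
    shift-weight-≤ = ∑-pairs-≤ pair fixed

    shift-weight-< : ∀ k X → ∣ X ∣ ≡ k → shifted X ≡ true → A X ≡ false → A (τ X) ≡ true →
                     ∑ k (weigh v (shift A)) < ∑ k (weigh v A)
    shift-weight-< k X e sX ¬AX AτX = ∑-pairs-< pair fixed k X e strict
      where
      move : ∀ a a′ → a ≡ false → a′ ≡ true →
             ⟦ a ∨ a′ ⟧ * v X + ⟦ a ∧ a′ ⟧ * v (τ X) < ⟦ a ⟧ * v X + ⟦ a′ ⟧ * v (τ X)
      move false true refl refl = ≤-<-trans (≤-reflexive (+-identityʳ (v X + 0))) (+-monoˡ-< 0 (v-dec X sX))
      strict : weigh v (shift A) X + weigh v (shift A) (τ X) < weigh v A X + weigh v A (τ X)
      strict = subst₂ (λ p q → ⟦ p ⟧ * v X + ⟦ q ⟧ * v (τ X) < weigh v A X + weigh v A (τ X))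
        (sym (shift-at A X sX)) (sym (shift-at-τ A X sX)) (move (A X) (A (τ X)) ¬AX AτX)

module _ {i j : Fin n} (t : Transposition i j) where
  open Transposition t
  private
    module L = Shift t
    module R = Shift (transposition-sym t)

  -- The opposite directions are essential: if `A` contains only `τ X` and `B` only `X`, shifting
  -- both towards `i` would merge the two sets into one, whereas opposite shifts exchange them.
  level-∪-shift : ∀ k A B → level k (A ∪ᶠ B) ≤ level k (L.shift A ∪ᶠ R.shift B)
  level-∪-shift k A B = L.∑-pairs-≤ pair fixed k
    where
    ∪-pair : ∀ a a′ b b′ → ⟦ a ∨ b ⟧ + ⟦ a′ ∨ b′ ⟧ ≤ ⟦ (a ∨ a′) ∨ (b′ ∧ b) ⟧ + ⟦ (a ∧ a′) ∨ (b′ ∨ b) ⟧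
    ∪-pair false false false false = z≤n
    ∪-pair false false false true  = ≤-refl
    ∪-pair false false true  false = ≤-refl
    ∪-pair false false true  true  = ≤-refl
    ∪-pair false true  false false = ≤-refl
    ∪-pair false true  false true  = s≤s z≤n
    ∪-pair false true  true  false = ≤-refl
    ∪-pair false true  true  true  = ≤-refl
    ∪-pair true  false false false = ≤-refl
    ∪-pair true  false false true  = ≤-refl
    ∪-pair true  false true  false = s≤s z≤n
    ∪-pair true  false true  true  = ≤-refl
    ∪-pair true  true  b     b′    = ≤-refl
    shiftedʳ : ∀ X → L.shifted X ≡ true → R.shifted (τ X) ≡ true
    shiftedʳ X sX = trans (cong₂ (λ a b → a ∧ not b) (lookup-j X) (lookup-i X)) sX
    pair : ∀ X → L.shifted X ≡ true → ⟦ (A ∪ᶠ B) X ⟧ + ⟦ (A ∪ᶠ B) (τ X) ⟧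
         ≤ ⟦ (L.shift A ∪ᶠ R.shift B) X ⟧ + ⟦ (L.shift A ∪ᶠ R.shift B) (τ X) ⟧
    pair X sX = subst₂ (λ p q → ⟦ (A ∪ᶠ B) X ⟧ + ⟦ (A ∪ᶠ B) (τ X) ⟧ ≤ ⟦ p ⟧ + ⟦ q ⟧)
      (cong₂ _∨_ (sym (L.shift-at A X sX))
        (sym (subst (λ Y → R.shift B Y ≡ B (τ X) ∧ B Y) (involutive X) (R.shift-at-τ B (τ X) (shiftedʳ X sX)))))
      (cong₂ _∨_ (sym (L.shift-at-τ A X sX))
        (sym (trans (R.shift-at B (τ X) (shiftedʳ X sX)) (cong (λ Y → B (τ X) ∨ B Y) (involutive X)))))
      (∪-pair (A X) (A (τ X)) (B X) (B (τ X)))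
    fixed : ∀ X → lookup X i ≡ lookup X j → ⟦ (A ∪ᶠ B) X ⟧ ≤ ⟦ (L.shift A ∪ᶠ R.shift B) X ⟧
    fixed X e = ≤-reflexive (cong₂ (λ a b → ⟦ a ∨ b ⟧) (sym (L.shift-fixed A X e)) (sym (R.shift-fixed B X (sym e))))

-- Undoing a shift

Disjoint : Subset n → Subset n → Set
Disjoint X Y = ∀ x → lookup X x ≡ true → lookup Y x ≡ false

false≢true : ∀ {b} → b ≡ false → b ≢ true
false≢true refl ()

≢true⇒≡false : ∀ {b} → b ≢ true → b ≡ false
≢true⇒≡false {false} _ = refl
≢true⇒≡false {true}  h = contradiction refl h

disjoint-sym : ∀ {X Y : Subset n} → Disjoint X Y → Disjoint Y X
disjoint-sym d x Yx = ≢true⇒≡false λ Xx → false≢true (d x Xx) Yx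

disjoint⇒∣∩∣≡0 : ∀ {X Y : Subset n} → Disjoint X Y → ∣ X ∩ˢ Y ∣ ≡ 0
disjoint⇒∣∩∣≡0 {X = []}        {[]}        d = refl
disjoint⇒∣∩∣≡0 {X = true ∷ X}  {false ∷ Y} d = disjoint⇒∣∩∣≡0 {X = X} {Y} (d ∘ suc)
disjoint⇒∣∩∣≡0 {X = true ∷ X}  {true ∷ Y}  d = contradiction (d zero refl) λ ()
disjoint⇒∣∩∣≡0 {X = false ∷ X} {b ∷ Y}     d = disjoint⇒∣∩∣≡0 {X = X} {Y} (d ∘ suc)

intersecting⇒¬disjoint : ∀ {A : SetFamily n} → 1 -Intersecting A → ∀ {X Y} → A X ≡ true → A Y ≡ true → ¬ Disjoint X Y
intersecting⇒¬disjoint int {X} {Y} AX AY d =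
  contradiction (int AX AY) (<⇒≱ (s≤s (≤-reflexive (disjoint⇒∣∩∣≡0 {X = X} {Y} d))))

avoid : ∀ s (W : Subset n) → s + ∣ W ∣ ≤ n → ∃[ Y ] (∣ Y ∣ ≡ s × Disjoint W Y)
avoid zero [] _ = [] , refl , λ ()
avoid {suc n} s (true ∷ W) h with avoid s W (≤-pred (≤-trans (≤-reflexive (sym (+-suc s ∣ W ∣))) h))
... | Y , e , d = false ∷ Y , e , λ { zero _ → refl ; (suc x) → d x }
avoid zero (false ∷ W) h with avoid 0 W (∣p∣≤n W)
... | Y , e , d = false ∷ Y , e , λ { (suc x) → d x }
avoid (suc s) (false ∷ W) (s≤s h) with avoid s W h
... | Y , e , d = true ∷ Y , cong suc e , λ { (suc x) → d x }

∣∪∣≤ : ∀ (X Y : Subset n) → ∣ X ∪ˢ Y ∣ ≤ ∣ X ∣ + ∣ Y ∣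
∣∪∣≤ []          []          = z≤n
∣∪∣≤ (true ∷ X)  (true ∷ Y)  = s≤s (≤-trans (∣∪∣≤ X Y) (+-monoʳ-≤ ∣ X ∣ (n≤1+n ∣ Y ∣)))
∣∪∣≤ (true ∷ X)  (false ∷ Y) = s≤s (∣∪∣≤ X Y)
∣∪∣≤ (false ∷ X) (true ∷ Y)  = ≤-trans (s≤s (∣∪∣≤ X Y)) (≤-reflexive (sym (+-suc ∣ X ∣ ∣ Y ∣)))
∣∪∣≤ (false ∷ X) (false ∷ Y) = ∣∪∣≤ X Y

disjoint-∪ˡ : ∀ {X Y Z : Subset n} → Disjoint (X ∪ˢ Y) Z → Disjoint X Z
disjoint-∪ˡ {X = X} {Y} d x Xx = d x (trans (lookup-zipWith _∨_ x X Y) (∨-introˡ Xx))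

disjoint-∪ʳ : ∀ {X Y Z : Subset n} → Disjoint (X ∪ˢ Y) Z → Disjoint Y Z
disjoint-∪ʳ {X = X} {Y} d x Yx = d x (trans (lookup-zipWith _∨_ x X Y) (∨-introʳ {lookup X x} Yx))

insert delete : Fin n → Subset n → Subset n
insert x X = X [ x ]≔ true
delete x X = X [ x ]≔ false

∣insert∣ : ∀ x (X : Subset n) → lookup X x ≡ false → ∣ insert x X ∣ ≡ suc ∣ X ∣
∣insert∣ zero    (false ∷ X) e = refl
∣insert∣ (suc x) (false ∷ X) e = ∣insert∣ x X e
∣insert∣ (suc x) (true ∷ X)  e = cong suc (∣insert∣ x X e)

∣insert∣≤ : ∀ x (X : Subset n) → ∣ insert x X ∣ ≤ suc ∣ X ∣
∣insert∣≤ zero    (false ∷ X) = ≤-refl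
∣insert∣≤ zero    (true ∷ X)  = n≤1+n _
∣insert∣≤ (suc x) (false ∷ X) = ∣insert∣≤ x X
∣insert∣≤ (suc x) (true ∷ X)  = s≤s (∣insert∣≤ x X)

∣delete∣ : ∀ x (X : Subset n) → lookup X x ≡ true → suc ∣ delete x X ∣ ≡ ∣ X ∣
∣delete∣ zero    (true ∷ X)  e = refl
∣delete∣ (suc x) (false ∷ X) e = ∣delete∣ x X e
∣delete∣ (suc x) (true ∷ X)  e = cong suc (∣delete∣ x X e)

insert-∋ : ∀ x (X : Subset n) → lookup (insert x X) x ≡ true
insert-∋ x X = lookup∘update x X true

insert-≢ : ∀ {x y} (X : Subset n) → y ≢ x → lookup (insert x X) y ≡ lookup X y
insert-≢ X y≢x = lookup∘update′ y≢x X true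

insert-⊇ : ∀ {x y} (X : Subset n) → lookup X y ≡ true → lookup (insert x X) y ≡ true
insert-⊇ {x = x} {y} X Xy with y Fin.≟ x
... | yes refl = insert-∋ x X
... | no y≢x   = trans (insert-≢ X y≢x) Xy

lookup-injective : ∀ {X Y : Subset n} → (∀ x → lookup X x ≡ lookup Y x) → X ≡ Y
lookup-injective {X = []}    {[]}    h = refl
lookup-injective {X = a ∷ X} {b ∷ Y} h = cong₂ _∷_ (h zero) (lookup-injective (h ∘ suc))

∣∣-mono : ∀ {X Y : Subset n} → (∀ x → lookup X x ≡ true → lookup Y x ≡ true) → ∣ X ∣ ≤ ∣ Y ∣
∣∣-mono {X = []}        {[]}        h = z≤n
∣∣-mono {X = true ∷ X}  {true ∷ Y}  h = s≤s (∣∣-mono {X = X} {Y} (h ∘ suc))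
∣∣-mono {X = true ∷ X}  {false ∷ Y} h = contradiction (h zero refl) λ ()
∣∣-mono {X = false ∷ X} {true ∷ Y}  h = m≤n⇒m≤1+n (∣∣-mono {X = X} {Y} (h ∘ suc))
∣∣-mono {X = false ∷ X} {false ∷ Y} h = ∣∣-mono {X = X} {Y} (h ∘ suc)

∣∣-mono-< : ∀ {X Y : Subset n} → (∀ x → lookup X x ≡ true → lookup Y x ≡ true) →
            ∀ a → lookup X a ≡ false → lookup Y a ≡ true → ∣ X ∣ < ∣ Y ∣
∣∣-mono-< {X = X} {Y} h a Xa Ya = ≤-trans (≤-reflexive (sym (∣insert∣ a X Xa))) (∣∣-mono {X = insert a X} {Y} sub)
  where
  sub : ∀ x → lookup (insert a X) x ≡ true → lookup Y x ≡ true
  sub x p with x Fin.≟ a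
  ... | yes refl = Ya
  ... | no x≢a   = h x (trans (sym (insert-≢ X x≢a)) p)

_∖_ : Subset n → Subset n → Subset n
X ∖ Y = X ∩ˢ ∁ Y

lookup-∖ : ∀ (X Y : Subset n) x → lookup (X ∖ Y) x ≡ lookup X x ∧ not (lookup Y x)
lookup-∖ X Y x = trans (lookup-zipWith _∧_ x X (∁ Y)) (cong (lookup X x ∧_) (lookup-map x not Y))

difference? : ∀ (X Y : Subset n) → (∃[ a ] (lookup X a ≡ true × lookup Y a ≡ false))
              ⊎ (∀ a → lookup X a ≡ true → lookup Y a ≡ true)
difference? X Y with any? (λ a → (lookup X a Bool.≟ true) ×-dec (lookup Y a Bool.≟ false))
... | yes p = inj₁ p
... | no ¬p = inj₂ λ a Xa → Boolₚ.¬-not λ Ya → ¬p (a , Xa , Ya)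

equal-or-exchange : ∀ (X Y : Subset n) → ∣ X ∣ ≡ ∣ Y ∣ → X ≡ Y
  ⊎ ∃[ a ] ∃[ b ] ((lookup X a ≡ true × lookup Y a ≡ false) × (lookup Y b ≡ true × lookup X b ≡ false))
equal-or-exchange X Y e with difference? X Y | difference? Y X
... | inj₁ (a , p) | inj₁ (b , q)       = inj₂ (a , b , p , q)
... | inj₁ (a , p , q) | inj₂ Y⊆X       = contradiction e (<⇒≢ (∣∣-mono-< {X = Y} {X} Y⊆X a q p) ∘ sym)
... | inj₂ X⊆Y | inj₁ (b , p , q)       = contradiction e (<⇒≢ (∣∣-mono-< {X = X} {Y} X⊆Y b q p))
... | inj₂ X⊆Y | inj₂ Y⊆X               = inj₁ (lookup-injective λ x → both (X⊆Y x) (Y⊆X x))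
  where
  both : ∀ {a b} → (a ≡ true → b ≡ true) → (b ≡ true → a ≡ true) → a ≡ b
  both {true}          f g = sym (f refl)
  both {false} {true}  f g = g refl
  both {false} {false} f g = refl

-- The form of n ≥ 2κ+4 that also holds for κ = 0 and small n.
Roomy : ℕ → ℕ → Set
Roomy κ n = ∀ (W : Subset n) → ∣ W ∣ ≤ 4 + κ → κ + ∣ W ∣ ≤ n

-- Connectivity of Kneser graphs

module Kneser {κ : ℕ} (roomy : Roomy κ n) (V : Subset n) (∣V∣≤3 : ∣ V ∣ ≤ 3) where

  Vertex : Subset n → Set
  Vertex Y = ∣ Y ∣ ≡ κ × Disjoint V Y

  module _ (P : Subset n → Set) (step : ∀ {Y Z} → Vertex Y → Vertex Z → Disjoint Y Z → P Y → P Z) where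

    -- Exchanging one point of `Y` for one of `Z` is a path of length two: `Y` and `Y₁` both lie in
    -- the set `U` of κ + 1 points, and a vertex `W` disjoint from `U` is adjacent to both. Each
    -- exchange brings `Y` closer to `Z`.
    connected-by : ∀ fuel Y Z → ∣ Y ∖ Z ∣ < fuel → Vertex Y → Vertex Z → P Y → P Z
    connected-by (suc fuel) Y Z (s≤s lt) vY vZ PY with equal-or-exchange Y Z (trans (proj₁ vY) (sym (proj₁ vZ)))
    ... | inj₁ refl = PY
    ... | inj₂ (a , b , (Ya , Za) , (Zb , Yb)) =
      connected-by fuel Y₁ Z (<-≤-trans closer lt) vY₁ vZ (step {W} {Y₁} vW vY₁ (disjoint-sym {X = Y₁} {W} Y₁#W) (step {Y} {W} vY vW Y#W PY))
      where
      Y₁ U : Subset n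
      Y₁ = insert b (delete a Y)
      U = insert b Y
      b≢a : b ≢ a
      b≢a refl = false≢true Yb Ya
      Y₁⊆U : ∀ x → lookup Y₁ x ≡ true → lookup U x ≡ true
      Y₁⊆U x p with x Fin.≟ b
      ... | yes refl = insert-∋ b Y
      ... | no x≢b with x Fin.≟ a
      ...   | yes refl = contradiction (trans (sym (insert-≢ (delete a Y) x≢b)) p) (false≢true (lookup∘update a Y false))
      ...   | no x≢a = trans (insert-≢ Y x≢b)
                        (trans (sym (lookup∘update′ x≢a Y false)) (trans (sym (insert-≢ (delete a Y) x≢b)) p))
      found : ∃[ W ] (∣ W ∣ ≡ κ × Disjoint (U ∪ˢ V) W)
      -- At most κ + 1 points in `U` and three in `V`: this is the constant `4 + κ` of `Roomy`.
      found = avoid κ (U ∪ˢ V) (roomy (U ∪ˢ V) (≤-trans (∣∪∣≤ U V)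
                (≤-trans (+-mono-≤ (≤-trans (∣insert∣≤ b Y) (s≤s (≤-reflexive (proj₁ vY)))) ∣V∣≤3)
                         (≤-reflexive (+-comm (suc κ) 3)))))
      W : Subset n
      W = proj₁ found
      U#W : Disjoint U W
      U#W = disjoint-∪ˡ {X = U} {V} {W} (proj₂ (proj₂ found))
      vW : Vertex W
      vW = proj₁ (proj₂ found) , disjoint-∪ʳ {X = U} {V} {W} (proj₂ (proj₂ found))
      Y#W : Disjoint Y W
      Y#W x Yx = U#W x (insert-⊇ Y Yx)
      Y₁#W : Disjoint Y₁ W
      Y₁#W x p = U#W x (Y₁⊆U x p)
      vY₁ : Vertex Y₁
      vY₁ = trans (∣insert∣ b (delete a Y) (trans (lookup∘update′ b≢a Y false) Yb))
                  (trans (∣delete∣ a Y Ya) (proj₁ vY)) , avoids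
        where
        avoids : Disjoint V Y₁
        avoids x Vx = ≢true⇒≡false λ Y₁x → bad (x Fin.≟ b) Y₁x
          where
          bad : Dec (x ≡ b) → lookup Y₁ x ≢ true
          bad (yes refl) _  = false≢true (proj₂ vZ x Vx) Zb
          bad (no x≢b) Y₁x = false≢true (proj₂ vY x Vx) (trans (sym (insert-≢ Y x≢b)) (Y₁⊆U x Y₁x))
      closer : ∣ Y₁ ∖ Z ∣ < ∣ Y ∖ Z ∣
      closer = ∣∣-mono-< {X = Y₁ ∖ Z} {Y ∖ Z} sub a
        (trans (lookup-∖ Y₁ Z a) (cong (_∧ not (lookup Z a))
          (trans (insert-≢ (delete a Y) (b≢a ∘ sym)) (lookup∘update a Y false))))
        (trans (lookup-∖ Y Z a) (∧-intro Ya (cong not Za)))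
        where
        sub : ∀ x → lookup (Y₁ ∖ Z) x ≡ true → lookup (Y ∖ Z) x ≡ true
        sub x p = go (x Fin.≟ b) (∧-elim (trans (sym (lookup-∖ Y₁ Z x)) p))
          where
          go : Dec (x ≡ b) → lookup Y₁ x ≡ true × not (lookup Z x) ≡ true → lookup (Y ∖ Z) x ≡ true
          go (yes refl) (_ , ¬Zb) = contradiction (trans (sym (cong not Zb)) ¬Zb) λ ()
          go (no x≢b) (Y₁x , ¬Zx) = trans (lookup-∖ Y Z x) (∧-intro (trans (sym (insert-≢ Y x≢b)) (Y₁⊆U x Y₁x)) ¬Zx)

    connected : ∀ {Y Z} → Vertex Y → Vertex Z → P Y → P Z
    connected {Y} {Z} = connected-by (suc ∣ Y ∖ Z ∣) Y Z ≤-refl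

∣∅∣ : ∀ n → ∣ ∅ˢ {n} ∣ ≡ 0
∣∅∣ zero    = refl
∣∅∣ (suc n) = ∣∅∣ n

-- Pulling a star back through one shift

module Unshift {κ : ℕ} (roomy : Roomy κ n) {i j : Fin n} (i≢j : i ≢ j) (t : Transposition i j)
               {A : SetFamily n} (int : 1 -Intersecting A) where
  open Transposition t
  open Shift t

  member-or-partner : ∀ {X} → A X ≡ true → shift A X ≡ true ⊎ shift A (τ X) ≡ true
  member-or-partner {X} AX with orientation X
  ... | inj₁ sX        = inj₁ (trans (shift-at A X sX) (∨-introˡ AX))
  ... | inj₂ (inj₁ sτX) = inj₂ (trans (shift-at A (τ X) sτX)
                                 (∨-introʳ {A (τ X)} (trans (cong A (involutive X)) AX)))
  ... | inj₂ (inj₂ e)  = inj₁ (trans (shift-fixed A X e) AX)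

  unshift-≢ : ∀ {x} → x ≢ i → x ≢ j → Star (suc κ) x (shift A) → Star (suc κ) x A
  unshift-≢ x≢i x≢j st X e AX with member-or-partner AX
  ... | inj₁ p = st X e p
  ... | inj₂ p = trans (sym (lookup-≢ X x≢i x≢j)) (st (τ X) (trans (∣τ∣ X) e) p)

  -- The shift moves only sets that contain `j`, so a member avoiding `j` would survive it and
  -- violate the star.
  unshift-j : Star (suc κ) j (shift A) → Star (suc κ) j A
  unshift-j st X e AX = decide (lookup X j) refl (lookup X i) refl
    where
    decide : ∀ b → lookup X j ≡ b → ∀ c → lookup X i ≡ c → lookup X j ≡ true
    decide true  Xj _ _ = Xj
    decide false Xj true Xi = st X e (trans (shift-at A X (cong₂ (λ a b → a ∧ not b) Xi Xj)) (∨-introˡ AX))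
    decide false Xj false Xi = st X e (trans (shift-fixed A X (trans Xi (sym Xj))) AX)

  module _ {z : Fin n} (z≢i : z ≢ i)
           (full : ∀ X → ∣ X ∣ ≡ suc κ → lookup X i ≡ true → lookup X z ≡ false → shift A X ≡ true) where

    private
      V : Subset n
      -- For `Y` disjoint from `V`, adding `i` gives a set to which `full` applies (it avoids `z`)
      -- and whose partner is obtained by adding `j` instead.
      V = insert i (insert j (insert z ∅ˢ))

      ∣V∣≤3 : ∣ V ∣ ≤ 3
      ∣V∣≤3 = ≤-trans (∣insert∣≤ i (insert j (insert z ∅ˢ)))
              (s≤s (≤-trans (∣insert∣≤ j (insert z ∅ˢ)) (s≤s (≤-trans (∣insert∣≤ z ∅ˢ) (s≤s (≤-reflexive (∣∅∣ n)))))))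

      i∈V : lookup V i ≡ true
      i∈V = insert-∋ i (insert j (insert z ∅ˢ))
      j∈V : lookup V j ≡ true
      j∈V = insert-⊇ (insert j (insert z ∅ˢ)) (insert-∋ j (insert z ∅ˢ))
      z∈V : lookup V z ≡ true
      z∈V = insert-⊇ (insert j (insert z ∅ˢ)) (insert-⊇ (insert z ∅ˢ) (insert-∋ z ∅ˢ))

    open Kneser {κ = κ} roomy V ∣V∣≤3

    private
      viaᵢ viaⱼ : Subset n → Subset n
      viaᵢ Y = insert i Y
      viaⱼ Y = τ (insert i Y)

      either : ∀ {Y} → Vertex Y → A (viaᵢ Y) ≡ true ⊎ A (viaⱼ Y) ≡ true
      either {Y} (∣Y∣ , V#Y) = ∨-elim (trans (sym (shift-at A (viaᵢ Y) isShifted))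
        (full (viaᵢ Y) (trans (∣insert∣ i Y (V#Y i i∈V)) (cong suc ∣Y∣)) (insert-∋ i Y)
              (trans (insert-≢ Y z≢i) (V#Y z z∈V))))
        where
        isShifted : shifted (viaᵢ Y) ≡ true
        isShifted = cong₂ (λ a b → a ∧ not b) (insert-∋ i Y) (trans (insert-≢ Y (i≢j ∘ sym)) (V#Y j j∈V))

      disjoint-viaᵢ : ∀ {X Y} → lookup X i ≡ false → Disjoint X Y → Disjoint X (viaᵢ Y)
      disjoint-viaᵢ {X} {Y} Xi d x Xx with x Fin.≟ i
      ... | yes refl = contradiction Xx (false≢true Xi)
      ... | no x≢i   = trans (insert-≢ Y x≢i) (d x Xx)

      disjoint-viaⱼ : ∀ {X Y} → Vertex Y → lookup X j ≡ false → Disjoint X Y → Disjoint X (viaⱼ Y)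
      disjoint-viaⱼ {X} {Y} (_ , V#Y) Xj d x Xx with x Fin.≟ i | x Fin.≟ j
      ... | yes refl | _        = trans (lookup-i (viaᵢ Y)) (trans (insert-≢ Y (i≢j ∘ sym)) (V#Y j j∈V))
      ... | no _     | yes refl = contradiction Xx (false≢true Xj)
      ... | no x≢i   | no x≢j   = trans (lookup-≢ (viaᵢ Y) x≢i x≢j) (trans (insert-≢ Y x≢i) (d x Xx))

      -- For `Z` one of the two versions is in `A`; the version through `j` is disjoint from
      -- `viaᵢ Y`, so the choice of `i` spreads along the edges of the Kneser graph.
      step : ∀ {Y Z} → Vertex Y → Vertex Z → Disjoint Y Z → A (viaᵢ Y) ≡ true → A (viaᵢ Z) ≡ true
      step {Y} {Z} vY vZ d AY with either vZ
      ... | inj₁ AZ = AZ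
      ... | inj₂ AZ = contradiction (disjoint-viaⱼ {viaᵢ Y} {Z} vZ
                          (trans (insert-≢ Y (i≢j ∘ sym)) (proj₂ vY j j∈V)) viaᵢY#Z)
                        (intersecting⇒¬disjoint {A = A} int AY AZ)
        where
        viaᵢY#Z : Disjoint (viaᵢ Y) Z
        viaᵢY#Z x p with x Fin.≟ i
        ... | yes refl = proj₂ vZ i i∈V
        ... | no x≢i   = d x (trans (sym (insert-≢ Y x≢i)) p)

      vertex-avoiding : ∀ X → ∣ X ∣ ≤ suc κ → ∃[ Y ] (Vertex Y × Disjoint X Y)
      vertex-avoiding X ∣X∣≤ = found (avoid κ (X ∪ˢ V) (roomy (X ∪ˢ V) (≤-trans (∣∪∣≤ X V)
          (≤-trans (+-mono-≤ ∣X∣≤ ∣V∣≤3) (≤-reflexive (+-comm (suc κ) 3))))))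
        where
        found : ∃[ Y ] (∣ Y ∣ ≡ κ × Disjoint (X ∪ˢ V) Y) → ∃[ Y ] (Vertex Y × Disjoint X Y)
        found (Y , e , d) = Y , (e , disjoint-∪ʳ {X = X} {V} {Y} d) , disjoint-∪ˡ {X = X} {V} {Y} d

    -- By connectivity either all sets `viaᵢ Y` are members or none is, and in the latter case all
    -- `viaⱼ Y` are. A member missing the centre so determined would be disjoint from one of them,
    -- for a vertex `Y` chosen off that member.
    unshift-i : Star (suc κ) i A ⊎ Star (suc κ) j A
    unshift-i = decide (vertex-avoiding ∅ˢ (≤-trans (≤-reflexive (∣∅∣ n)) z≤n))
      where
      decide : ∃[ Y ] (Vertex Y × Disjoint ∅ˢ Y) → Star (suc κ) i A ⊎ Star (suc κ) j A
      decide (Y₀ , vY₀ , _) with A (viaᵢ Y₀) in AY₀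
      ... | true = inj₁ star
        where
        star : Star (suc κ) i A
        star X e AX = Boolₚ.¬-not λ Xi → hit Xi (vertex-avoiding X (≤-reflexive e))
          where
          hit : lookup X i ≡ false → ¬ (∃[ Y ] (Vertex Y × Disjoint X Y))
          hit Xi (Y , vY , d) = intersecting⇒¬disjoint {A = A} int AX
            (connected (λ Y → A (viaᵢ Y) ≡ true) step {Y₀} {Y} vY₀ vY AY₀) (disjoint-viaᵢ {X} {Y} Xi d)
      ... | false = inj₂ star
        where
        star : Star (suc κ) j A
        star X e AX = Boolₚ.¬-not λ Xj → hit Xj (vertex-avoiding X (≤-reflexive e))
          where
          hit : lookup X j ≡ false → ¬ (∃[ Y ] (Vertex Y × Disjoint X Y))
          hit Xj (Y , vY , d) with either vY
          ... | inj₁ AY = false≢true AY₀ (connected (λ Y → A (viaᵢ Y) ≡ true) step {Y} {Y₀} vY vY₀ AY)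
          ... | inj₂ AY = intersecting⇒¬disjoint {A = A} int AX AY (disjoint-viaⱼ {X} {Y} vY Xj d)

  unshift-star : ∀ {x z} → z ≢ x → Star (suc κ) x (shift A) →
    (∀ X → ∣ X ∣ ≡ suc κ → lookup X x ≡ true → lookup X z ≡ false → shift A X ≡ true) → ∃[ x′ ] Star (suc κ) x′ A
  unshift-star {x} z≢x st full with x Fin.≟ i | x Fin.≟ j
  ... | no x≢i   | no x≢j   = x , unshift-≢ x≢i x≢j st
  ... | no x≢i   | yes refl = j , unshift-j st
  ... | yes refl | _        = [ (λ s → i , s) , (λ s → j , s) ]′ (unshift-i z≢x full)

-- Union of two intersecting families of k-sets

↝⇒swap : ∀ {X Y : Subset (suc n)} → X ↝ Y →
  ∃[ p ] (lookup Y (inject₁ p) ≡ true × lookup Y (suc p) ≡ false × swap p Y ≡ X)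
↝⇒swap here = zero , refl , refl , refl
↝⇒swap (there {X = _ ∷ _} {_ ∷ _} {b} s) with ↝⇒swap s
... | p , Yi , Yj , e = suc p , Yi , Yj , cong (b ∷_) e

-- Termination measures for shifting one family to the left and the other to the right.
weightˡ weightʳ : Subset n → ℕ
weightˡ []      = 0
weightˡ (b ∷ X) = ⟦ b ⟧ + (weightˡ X + weightˡ X)
weightʳ []              = 0
weightʳ {suc n} (b ∷ X) = ⟦ b ⟧ * suc n + weightʳ X

weightˡ-< : ∀ (p : Fin n) X → only (inject₁ p) (suc p) X ≡ true → weightˡ X < weightˡ (swap p X)
weightˡ-< zero    (true ∷ false ∷ X) _ = s≤s (≤-reflexive (sym (+-suc (weightˡ X + weightˡ X) _)))
weightˡ-< (suc p) (b ∷ X)            e = +-monoʳ-< ⟦ b ⟧ (+-mono-< (weightˡ-< p X e) (weightˡ-< p X e))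

weightʳ-< : ∀ (p : Fin n) X → only (suc p) (inject₁ p) X ≡ true → weightʳ X < weightʳ (swap p X)
weightʳ-< {suc n} zero (false ∷ true ∷ X) _ = ≤-refl
weightʳ-< {n} (suc p) (b ∷ X) e = +-monoʳ-< (⟦ b ⟧ * suc n) (weightʳ-< p X e)

module _ {N κ M : ℕ} (M+κ : M + suc κ ≡ suc (suc N)) (golden : Golden (suc κ) M)
         (roomy : Roomy κ (suc (suc N))) where

  private
    k n′ S : ℕ
    k  = suc κ
    n′ = suc (suc N)
    S  = binomial (suc N) κ + binomial N κ

    Optimal : SetFamily n′ → SetFamily n′ → Set
    Optimal A B = level k (A ∪ᶠ B) ≤ S
      × (S ≤ level k (A ∪ᶠ B) → ∃[ x ] ∃[ y ] (x ≢ y × Star k x A × Star k y B))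

  -- A union of maximal size inside `star₂ x y` has no room to omit a set. This turns the two stars
  -- into the fullness that `unshift-star` and `centre-in-support` ask for.
  stars-full : ∀ {A B : SetFamily n′} {x y} → x ≢ y → (∀ X → ∣ X ∣ ≡ k → (A ∪ᶠ B) X ≡ true → star₂ x y X ≡ true) →
               S ≤ level k (A ∪ᶠ B) → ∀ X → ∣ X ∣ ≡ k → star₂ x y X ≡ true → (A ∪ᶠ B) X ≡ true
  stars-full {A} {B} {x} {y} x≢y sub S≤ = level-saturated k {A ∪ᶠ B} {star₂ x y} sub
    (≤-trans (≤-reflexive (level-star₂ N κ x y x≢y)) S≤)

  stars-⊆ : ∀ {A B : SetFamily n′} {x y} → Star k x A → Star k y B → ∀ X → ∣ X ∣ ≡ k → (A ∪ᶠ B) X ≡ true → star₂ x y X ≡ true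
  stars-⊆ {A} {B} {x} sA sB X e p with ∨-elim p
  ... | inj₁ AX = ∨-introˡ (sA X e AX)
  ... | inj₂ BX = ∨-introʳ {lookup X x} (sB X e BX)

  -- One star is too small to reach the bound.
  centres-distinct : ∀ {A B : SetFamily n′} {x w} → w ≢ x → Star k x A → Star k x B → ¬ (S ≤ level k (A ∪ᶠ B))
  centres-distinct {A} {B} {x} {w} w≢x sA sB S≤ = refute (avoid κ V (roomy V ∣V∣≤))
    where
    V : Subset n′
    V = insert w (insert x ∅ˢ)
    ∣V∣≤ : ∣ V ∣ ≤ 4 + κ
    ∣V∣≤ = ≤-trans (∣insert∣≤ w (insert x ∅ˢ)) (s≤s (≤-trans (∣insert∣≤ x ∅ˢ)
             (s≤s (≤-trans (≤-reflexive (∣∅∣ n′)) z≤n))))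
    ∪⊆x : ∀ X → ∣ X ∣ ≡ k → (A ∪ᶠ B) X ≡ true → lookup X x ≡ true
    ∪⊆x X e p = [ sA X e , sB X e ]′ (∨-elim p)
    refute : ¬ (∃[ Y ] (∣ Y ∣ ≡ κ × Disjoint V Y))
    refute (Y , ∣Y∣ , V#Y) = false≢true (trans (insert-≢ Y (w≢x ∘ sym)) (V#Y x (insert-⊇ (insert x ∅ˢ) (insert-∋ x ∅ˢ))))
      (∪⊆x X ∣X∣ (stars-full {A} {B} {x} {w} (w≢x ∘ sym) (λ X e p → ∨-introˡ (∪⊆x X e p)) S≤ X ∣X∣
                   (∨-introʳ {lookup X x} (insert-∋ w Y))))
      where
      X : Subset n′
      X = insert w Y
      ∣X∣ : ∣ X ∣ ≡ k
      ∣X∣ = trans (∣insert∣ w Y (V#Y w (insert-∋ w (insert x ∅ˢ)))) (cong suc ∣Y∣)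

  -- Equality for `A` and `B` forces it for the shifted pair, which then consists of two stars. A
  -- k-set through `x` but not `y` cannot lie in `B′`, so it lies in `A′`, and vice versa; hence
  -- both stars can be pulled back. Their centres stay distinct because a single star is too small.
  unshift-optimal : ∀ (p : Fin (suc N)) {A B} → 1 -Intersecting A → 1 -Intersecting B →
    Optimal (Shift.shift (adjacent p) A) (Shift.shift (transposition-sym (adjacent p)) B) → Optimal A B
  unshift-optimal p {A} {B} intA intB (bound , equality) = ≤-trans grow bound , unshift
    where
    t = adjacent p
    A′ B′ : SetFamily n′
    A′ = Shift.shift t A
    B′ = Shift.shift (transposition-sym t) B
    grow : level k (A ∪ᶠ B) ≤ level k (A′ ∪ᶠ B′)
    grow = level-∪-shift t k A B
    i≢j : ∀ {n} (p : Fin n) → inject₁ p ≢ suc p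
    i≢j (suc p) e = i≢j p (Finₚ.suc-injective e)
    other : ∀ x → ∃[ w ] (w ≢ x)
    other zero    = suc zero , λ ()
    other (suc x) = zero , λ ()
    unshift : S ≤ level k (A ∪ᶠ B) → ∃[ x ] ∃[ y ] (x ≢ y × Star k x A × Star k y B)
    unshift S≤ = fromShifted (equality (≤-trans S≤ grow))
      where
      fromShifted : ∃[ x ] ∃[ y ] (x ≢ y × Star k x A′ × Star k y B′) → ∃[ x ] ∃[ y ] (x ≢ y × Star k x A × Star k y B)
      fromShifted (x , y , x≢y , sA′ , sB′) = distinct
          (Unshift.unshift-star roomy (i≢j p) t {A} intA (x≢y ∘ sym) sA′ fullA)
          (Unshift.unshift-star roomy (i≢j p ∘ sym) (transposition-sym t) {B} intB x≢y sB′ fullB)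
        where
        full : ∀ X → ∣ X ∣ ≡ k → star₂ x y X ≡ true → A′ X ≡ true ⊎ B′ X ≡ true
        full X e p = ∨-elim {A′ X} (stars-full {A′} {B′} {x} {y} x≢y (stars-⊆ {A′} {B′} {x} {y} sA′ sB′) (≤-trans S≤ grow) X e p)
        fullA : ∀ X → ∣ X ∣ ≡ k → lookup X x ≡ true → lookup X y ≡ false → A′ X ≡ true
        fullA X e Xx Xy = [ (λ p → p) , (λ B′X → contradiction (sB′ X e B′X) (false≢true Xy)) ]′ (full X e (∨-introˡ Xx))
        fullB : ∀ X → ∣ X ∣ ≡ k → lookup X y ≡ true → lookup X x ≡ false → B′ X ≡ true
        fullB X e Xy Xx = [ (λ A′X → contradiction (sA′ X e A′X) (false≢true Xx)) , (λ p → p) ]′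
                            (full X e (∨-introʳ {lookup X x} Xy))
        distinct : ∃[ x′ ] Star k x′ A → ∃[ y′ ] Star k y′ B → ∃[ x ] ∃[ y ] (x ≢ y × Star k x A × Star k y B)
        distinct (x′ , sA) (y′ , sB) with x′ Fin.≟ y′
        ... | no x′≢y′ = x′ , y′ , x′≢y′ , sA , sB
        ... | yes refl = contradiction S≤ (centres-distinct {A} {B} (proj₂ (other x′)) sA sB)

  shifted-optimal : ∀ {A B} → LeftShifted A → RightShifted B → 1 -Intersecting A → 1 -Intersecting B → Optimal A B
  shifted-optimal {A} {B} shA shB intA intB = convert
    (∪-bound k {zero} {fromℕ (suc N)} {A} {B} (leftShifted-bound {κ = κ} M+κ golden A shA intA)
                                        (rightShifted-bound {κ = κ} M+κ golden B shB intB))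
    where
    S≡ : level k (star₂ zero (fromℕ (suc N))) ≡ S
    S≡ = level-star₂ N κ zero (fromℕ (suc N)) λ ()
    convert : level k (A ∪ᶠ B) ≤ level k (star₂ zero (fromℕ (suc N)))
            × (level k (star₂ zero (fromℕ (suc N))) ≤ level k (A ∪ᶠ B) → Star k zero A × Star k (fromℕ (suc N)) B) →
            Optimal A B
    convert (bound , equality) = ≤-trans bound (≤-reflexive S≡) ,
      λ S≤ → zero , fromℕ (suc N) , (λ ()) , equality (≤-trans (≤-reflexive S≡) S≤)

  Unshifted : ∀ {i j} → Transposition i j → SetFamily n′ → Subset n′ → Set
  Unshifted {i} {j} t A X = only i j X ≡ true × A X ≡ false × A (Transposition.τ t X) ≡ true

  unshifted? : ∀ {i j} (t : Transposition i j) A X → Dec (Unshifted t A X)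
  unshifted? {i} {j} t A X = (only i j X Bool.≟ true) ×-dec ((A X Bool.≟ false) ×-dec (A (Transposition.τ t X) Bool.≟ true))

  -- Both families are shifted at the same place, even when only one of them changes: the weight of
  -- the changed one drops and that of the other does not grow. If no place changes anything, `A` is
  -- left-shifted and `B` right-shifted.
  optimal-by : ∀ fuel A B → Uniform k A → Uniform k B → 1 -Intersecting A → 1 -Intersecting B →
    ∑ k (λ X → ⟦ A X ⟧ * weightˡ X) + ∑ k (λ X → ⟦ B X ⟧ * weightʳ X) < fuel → Optimal A B
  optimal-by (suc fuel) A B uniA uniB intA intB (s≤s lt)
    with any? (λ p → anySubset? (λ X → unshifted? (adjacent p) A X ⊎-dec unshifted? (transposition-sym (adjacent p)) B X))
  ... | no ¬u = shifted-optimal {A} {B} left right intA intB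
    where
    left : LeftShifted A
    left {X} {Y} s AX with ↝⇒swap s
    ... | p , Yi , Yj , refl = Boolₚ.¬-not λ ¬AY →
      ¬u (p , Y , inj₁ (cong₂ (λ a b → a ∧ not b) Yi Yj , ¬AY , AX))
    right : RightShifted B
    right {X} {Y} s BY with ↝⇒swap s
    ... | p , Yi , Yj , refl = Boolₚ.¬-not λ ¬BX →
      ¬u (p , X , inj₂ ( cong₂ (λ a b → a ∧ not b) (trans (Transposition.lookup-j (adjacent p) Y) Yi)
                                                  (trans (Transposition.lookup-i (adjacent p) Y) Yj)
                       , ¬BX , trans (cong B (swap-involutive p Y)) BY))
  ... | yes (p , X , u) = unshift-optimal p {A} {B} intA intB
      (optimal-by fuel A′ B′
        (Shift.shift-uniform t {A = A} uniA) (Shift.shift-uniform t′ {A = B} uniB)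
        (Shift.shift-intersecting t {A} intA) (Shift.shift-intersecting t′ {B} intB) (<-≤-trans (drop u) lt))
    where
    t = adjacent p
    t′ = transposition-sym t
    A′ B′ : SetFamily n′
    A′ = Shift.shift t A
    B′ = Shift.shift t′ B
    ∣X∣ : ∀ {C} → Uniform k C → C (swap p X) ≡ true → ∣ X ∣ ≡ k
    ∣X∣ uni CτX = trans (sym (∣swap∣ p X)) (uni CτX)
    drop : Unshifted t A X ⊎ Unshifted t′ B X →
      ∑ k (λ X → ⟦ A′ X ⟧ * weightˡ X) + ∑ k (λ X → ⟦ B′ X ⟧ * weightʳ X)
      < ∑ k (λ X → ⟦ A X ⟧ * weightˡ X) + ∑ k (λ X → ⟦ B X ⟧ * weightʳ X)
    drop (inj₁ (sX , ¬AX , AτX)) = +-mono-<-≤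
      (Shift.shift-weight-< t (weightˡ-< p) A k X (∣X∣ {A} uniA AτX) sX ¬AX AτX) (Shift.shift-weight-≤ t′ (weightʳ-< p) B k)
    drop (inj₂ (sX , ¬BX , BτX)) = +-mono-≤-<
      (Shift.shift-weight-≤ t (weightˡ-< p) A k) (Shift.shift-weight-< t′ (weightʳ-< p) B k X (∣X∣ {B} uniB BτX) sX ¬BX BτX)

  optimal : ∀ {A B} → Uniform k A → Uniform k B → 1 -Intersecting A → 1 -Intersecting B → Optimal A B
  optimal {A} {B} uniA uniB intA intB = optimal-by _ A B uniA uniB intA intB ≤-refl

-- Multisets as sets

-- A k-multiset of [m] corresponds to a k-subset of [m+k-1]: its support, followed by the word
-- 1^(a-1) 0 1^(b-1) 0 ... 1^(c-1) of length k-1 listing the positive multiplicities a, b, ..., c.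
data Code : Vec ℕ m → Subset m → Subset κ → Set
data Tail : ℕ → Vec ℕ m → Subset m → Subset κ → Set

data Code where
  absent  : ∀ {a : Vec ℕ m} {S} {e : Subset κ} → Code a S e → Code (0 ∷ a) (false ∷ S) e
  present : ∀ {x} {a : Vec ℕ m} {S} {e : Subset κ} → Tail x a S e → Code (suc x ∷ a) (true ∷ S) e

-- Tail x a S e: e encodes x further copies of the current element, then the multiset a.
data Tail where
  end  : Tail {m} 0 (replicate m 0) (replicate m false) []
  more : ∀ {x} {a : Vec ℕ m} {S} {e : Subset κ} → Tail x a S e → Tail (suc x) a S (true ∷ e)
  next : ∀ {a : Vec ℕ m} {S} {e : Subset κ} → Code a S e → Tail 0 a S (false ∷ e)

sum-0s : ∀ m → sum (replicate m 0) ≡ 0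
sum-0s zero    = refl
sum-0s (suc m) = sum-0s m

sum≡0⇒0s : ∀ (a : Vec ℕ m) → sum a ≡ 0 → a ≡ replicate m 0
sum≡0⇒0s []         e = refl
sum≡0⇒0s (zero ∷ a) e = cong (0 ∷_) (sum≡0⇒0s a e)

∣∣≡0⇒∅ : ∀ (S : Subset m) → ∣ S ∣ ≡ 0 → S ≡ ∅ˢ
∣∣≡0⇒∅ []          e = refl
∣∣≡0⇒∅ (false ∷ S) e = cong (false ∷_) (∣∣≡0⇒∅ S e)

code-sum : ∀ {a : Vec ℕ m} {S} {e : Subset κ} → Code a S e → sum a ≡ suc κ
tail-sum : ∀ {x} {a : Vec ℕ m} {S} {e : Subset κ} → Tail x a S e → x + sum a ≡ κ
code-sum (absent c)  = code-sum c
code-sum (present t) = cong suc (tail-sum t)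
tail-sum {m} end  = sum-0s m
tail-sum (more t) = cong suc (tail-sum t)
tail-sum (next c) = code-sum c

-- Each support point stands for the first copy of its element and each `true` of the word for a
-- further copy.
code-size : ∀ {a : Vec ℕ m} {S} {e : Subset κ} → Code a S e → ∣ S ∣ + ∣ e ∣ ≡ suc κ
tail-size : ∀ {x} {a : Vec ℕ m} {S} {e : Subset κ} → Tail x a S e → ∣ S ∣ + ∣ e ∣ ≡ κ
code-size (absent c)  = code-size c
code-size (present t) = cong suc (tail-size t)
tail-size {m} end  = trans (+-identityʳ _) (∣∅∣ m)
tail-size {S = S} (more {e = e} t) = trans (+-suc ∣ S ∣ ∣ e ∣) (cong suc (tail-size t))
tail-size (next c) = code-size c

encode : ∀ (a : Vec ℕ m) → sum a ≡ suc κ → ∃[ S ] ∃[ e ] Code {κ = κ} a S e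
encodeTail : ∀ x (a : Vec ℕ m) → x + sum a ≡ κ → ∃[ S ] ∃[ e ] Tail {κ = κ} x a S e
encode (zero ∷ a) s with encode a s
... | S , e , c = false ∷ S , e , absent c
encode (suc x ∷ a) s with encodeTail x a (suc-injective s)
... | S , e , t = true ∷ S , e , present t
encodeTail {κ = zero} zero a s rewrite sum≡0⇒0s a s = _ , [] , end
encodeTail {κ = suc κ} zero a s with encode a s
... | S , e , c = S , false ∷ e , next c
encodeTail {κ = suc κ} (suc x) a s with encodeTail x a (suc-injective s)
... | S , e , t = S , true ∷ e , more t

decode : ∀ (S : Subset m) (e : Subset κ) → ∣ S ∣ + ∣ e ∣ ≡ suc κ → ∃[ a ] Code a S e
decodeTail : ∀ (S : Subset m) (e : Subset κ) → ∣ S ∣ + ∣ e ∣ ≡ κ → ∃[ x ] ∃[ a ] Tail x a S e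
-- With no support left, the word would need κ + 1 ones in κ places.
decode {κ = κ} [] e s = contradiction (∣p∣≤n e) (<⇒≱ (≤-reflexive (sym s)))
decode (false ∷ S) e s with decode S e s
... | a , c = 0 ∷ a , absent c
decode (true ∷ S) e s with decodeTail S e (suc-injective s)
... | x , a , t = suc x ∷ a , present t
-- The word is used up, so the size leaves no further support points.
decodeTail S [] s rewrite ∣∣≡0⇒∅ S (trans (sym (+-identityʳ _)) s) = 0 , _ , end
decodeTail S (true ∷ e) s with decodeTail S e (suc-injective (trans (sym (+-suc ∣ S ∣ ∣ e ∣)) s))
... | x , a , t = suc x , a , more t
decodeTail S (false ∷ e) s with decode S e s
... | a , c = 0 , a , next c

code-functional : ∀ {a : Vec ℕ m} {S S′} {e e′ : Subset κ} → Code a S e → Code a S′ e′ → S ≡ S′ × e ≡ e′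
tail-functional : ∀ {x} {a : Vec ℕ m} {S S′} {e e′ : Subset κ} → Tail x a S e → Tail x a S′ e′ → S ≡ S′ × e ≡ e′
code-functional (absent c) (absent c′) with code-functional c c′
... | refl , refl = refl , refl
code-functional (present t) (present t′) with tail-functional t t′
... | refl , refl = refl , refl
tail-functional end end = refl , refl
tail-functional (more t) (more t′) with tail-functional t t′
... | refl , refl = refl , refl
tail-functional (next c) (next c′) with code-functional c c′
... | refl , refl = refl , refl

code-injective : ∀ {a a′ : Vec ℕ m} {S} {e : Subset κ} → Code a S e → Code a′ S e → a ≡ a′
tail-injective : ∀ {x x′} {a a′ : Vec ℕ m} {S} {e : Subset κ} → Tail x a S e → Tail x′ a′ S e → x ≡ x′ × a ≡ a′
code-injective (absent c) (absent c′) = cong (0 ∷_) (code-injective c c′)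
code-injective (present t) (present t′) with tail-injective t t′
... | refl , refl = refl
tail-injective t end = endOnly t
  where
  endOnly : ∀ {x} {a : Vec ℕ m} {S} → Tail x a S [] → x ≡ 0 × a ≡ replicate m 0
  endOnly end = refl , refl
tail-injective (more t) (more t′) with tail-injective t t′
... | refl , refl = refl , refl
tail-injective (next c) (next c′) = refl , code-injective c c′

code-support : ∀ {a : Vec ℕ m} {S} {e : Subset κ} → Code a S e → ∀ i → 1 ≤ lookup a i ⇔ lookup S i ≡ true
tail-support : ∀ {x} {a : Vec ℕ m} {S} {e : Subset κ} → Tail x a S e → ∀ i → 1 ≤ lookup a i ⇔ lookup S i ≡ true
code-support (absent c)  zero    = mk⇔ (λ ()) (λ ())
code-support (absent c)  (suc i) = code-support c i
code-support (present t) zero    = mk⇔ (λ _ → refl) (λ _ → s≤s z≤n)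
code-support (present t) (suc i) = tail-support t i
tail-support (more t) i = tail-support t i
tail-support (next c) i = code-support c i
tail-support end i rewrite lookup-replicate i 0 | lookup-replicate i false = mk⇔ (λ ()) (λ ())

∣++∣ : ∀ (S : Subset m) (e : Subset κ) → ∣ S ++ e ∣ ≡ ∣ S ∣ + ∣ e ∣
∣++∣ []          e = refl
∣++∣ (true ∷ S)  e = cong suc (∣++∣ S e)
∣++∣ (false ∷ S) e = ∣++∣ S e

meet-point : ∀ (a b : Vec ℕ m) → ¬ (sum (zipWith _⊓_ a b) ≡ 0) → ∃[ i ] (1 ≤ lookup a i × 1 ≤ lookup b i)
meet-point []          []          h = contradiction refl h
meet-point (suc x ∷ a) (suc y ∷ b) h = zero , s≤s z≤n , s≤s z≤n
meet-point (zero ∷ a)  (y ∷ b)     h with meet-point a b h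
... | i , p , q = suc i , p , q
meet-point (suc x ∷ a) (zero ∷ b)  h with meet-point a b h
... | i , p , q = suc i , p , q

level-singleton : ∀ k {A : SetFamily n} Y → ∣ Y ∣ ≡ k → A Y ≡ true → (∀ X → A X ≡ true → X ≡ Y) → level k A ≡ 1
level-singleton zero    {A} []          e AY h = cong ⟦_⟧ AY
level-singleton zero    {A} (false ∷ Y) e AY h = level-singleton zero {A ∘ (false ∷_)} Y e AY (λ X p → cong Vec.tail (h (false ∷ X) p))
level-singleton (suc k) {A} (false ∷ Y) e AY h =
  (cong₂ _+_ (level-singleton (suc k) {A ∘ (false ∷_)} Y e AY (λ X p → cong Vec.tail (h (false ∷ X) p)))
             (level-empty k {A ∘ (true ∷_)} (λ X _ → ≢true⇒≡false (λ p → contradiction (cong Vec.head (h (true ∷ X) p)) λ ()))))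
level-singleton (suc k) {A} (true ∷ Y) e AY h =
  cong₂ _+_ (level-empty (suc k) {A ∘ (false ∷_)} (λ X _ → ≢true⇒≡false (λ p → contradiction (cong Vec.head (h (false ∷ X) p)) λ ())))
            (level-singleton k {A ∘ (true ∷_)} Y (suc-injective e) AY (λ X p → cong Vec.tail (h (true ∷ X) p)))

-- Families of multisets as families of sets

module Encoding (m κ : ℕ) where

  -- A relation in place of two inverse maps: the bijection consists of existence (`encoding`,
  -- `decoding`) and uniqueness (`encodes-functional`, `encodes-injective`).
  _Encodes_ : Subset (m + κ) → Vec ℕ m → Set
  X Encodes a = ∃[ S ] ∃[ e ] (X ≡ S ++ e × Code {m} {κ} a S e)

  encodes-size : ∀ {X a} → X Encodes a → ∣ X ∣ ≡ suc κ
  encodes-size (S , e , refl , c) = trans (∣++∣ S e) (code-size c)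

  encodes-sum : ∀ {X a} → X Encodes a → sum a ≡ suc κ
  encodes-sum (_ , _ , _ , c) = code-sum c

  encodes-functional : ∀ {X Y a} → X Encodes a → Y Encodes a → X ≡ Y
  encodes-functional (S , e , refl , c) (S′ , e′ , refl , c′) with code-functional c c′
  ... | refl , refl = refl

  encodes-injective : ∀ {X a b} → X Encodes a → X Encodes b → a ≡ b
  encodes-injective (S , e , refl , c) (S′ , e′ , eq , c′) with ++-injective S S′ eq
  ... | refl , refl = code-injective c c′

  encodes-support : ∀ {X a} → X Encodes a → ∀ i → 1 ≤ lookup a i ⇔ lookup X (i ↑ˡ κ) ≡ true
  encodes-support (S , e , refl , c) i rewrite lookup-++ˡ S e i = code-support c i

  encoding : ∀ a → sum a ≡ suc κ → ∃[ X ] (X Encodes a)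
  encoding a s with encode a s
  ... | S , e , c = S ++ e , S , e , refl , c

  decoding : ∀ (X : Subset (m + κ)) → ∣ X ∣ ≡ suc κ → ∃[ a ] (X Encodes a)
  decoding X s with Vec.splitAt m X
  ... | S , e , refl with decode S e (trans (sym (∣++∣ S e)) s)
  ...   | a , c = a , S , e , refl , c

  code-in? : ∀ (F : Family m) (X : Subset (m + κ)) → Dec (∃[ a ] (X Encodes a × a ∈ F))
  code-in? F X with ∣ X ∣ ≟ suc κ
  ... | no ¬s = no λ (a , c , _) → ¬s (encodes-size {X} {a} c)
  ... | yes s with decoding X s
  ...   | a , c with DecMembership._∈?_ (≡-dec _≟_) a F
  ...     | yes a∈F = yes (a , c , a∈F)
  ...     | no a∉F  = no λ (b , c′ , b∈F) → a∉F (subst (_∈ F) (encodes-injective {X} {b} {a} c′ c) b∈F)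

  codes : Family m → SetFamily (m + κ)
  codes F X = does (code-in? F X)

  codes-intro : ∀ {F X a} → X Encodes a → a ∈ F → codes F X ≡ true
  codes-intro {F} {X} {a} c a∈F = dec-true (code-in? F X) (a , c , a∈F)

  codes-elim : ∀ {F X} → codes F X ≡ true → ∃[ a ] (X Encodes a × a ∈ F)
  codes-elim {F} {X} = does-true (code-in? F X)

  codes-uniform : ∀ F → Uniform (suc κ) (codes F)
  codes-uniform F {X} p = let a , c , _ = codes-elim {F} {X} p in encodes-size {X} {a} c

  -- More than `1 -Intersecting`: the common point lies among the first `m`, which is what confines
  -- the centres of stars to [m].
  common-support : ∀ {F} → Intersecting F → ∀ {X Y} → codes F X ≡ true → codes F Y ≡ true →
                   ∃[ i ] (lookup X (i ↑ˡ κ) ≡ true × lookup Y (i ↑ˡ κ) ≡ true)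
  common-support {F} int {X} {Y} p q with codes-elim {F} {X} p | codes-elim {F} {Y} q
  ... | a , cX , a∈F | b , cY , b∈F with meet-point a b (int a∈F b∈F)
  ...   | i , ai , bi = i , Equivalence.to (encodes-support {X} {a} cX i) ai , Equivalence.to (encodes-support {Y} {b} cY i) bi

  codes-intersecting : ∀ {F} → Intersecting F → 1 -Intersecting codes F
  codes-intersecting {F} int {X} {Y} p q with common-support {F} int {X} {Y} p q
  ... | i , Xi , Yi = common-point {X = X} {Y} (i ↑ˡ κ) Xi Yi

  level-codes : ∀ (U : Family m) → Unique U → FamilyOfKMultisets (suc κ) U → level (suc κ) (codes U) ≡ length U
  level-codes List.[] _ _ = level-empty (suc κ) {codes List.[]} (λ X _ → ≢true⇒≡false λ p → absurd (codes-elim {F = List.[]} {X} p))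
    where
    absurd : ∀ {X : Subset (m + κ)} → ¬ (∃[ a ] (X Encodes a × a ∈ List.[]))
    absurd (_ , _ , ())
  level-codes (a List.∷ U) (a∉U AllPairs.∷ uU) ms = trans
    (∑-cong (suc κ) (λ X _ → split X))
    (trans (∑-+ (suc κ) (⟦_⟧ ∘ single) (⟦_⟧ ∘ codes U))
      (cong₂ _+_ (level-singleton (suc κ) {single} Y (encodes-size {Y} {a} YEa) (dec-true (≡-dec Bool._≟_ Y Y) refl)
                    (λ X → does-true (≡-dec Bool._≟_ X Y)))
                 (level-codes U uU (ms ∘ Any.there))))
    where
    Y : Subset (m + κ)
    Y = proj₁ (encoding a (ms (Any.here refl)))
    YEa : Y Encodes a
    YEa = proj₂ (encoding a (ms (Any.here refl)))
    single : SetFamily (m + κ)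
    single X = does (≡-dec Bool._≟_ X Y)
    split : ∀ X → ⟦ codes (a List.∷ U) X ⟧ ≡ ⟦ single X ⟧ + ⟦ codes U X ⟧
    split X = go (≡-dec Bool._≟_ X Y)
      where
      go : (d : Dec (X ≡ Y)) → ⟦ codes (a List.∷ U) X ⟧ ≡ ⟦ does d ⟧ + ⟦ codes U X ⟧
      go (yes refl) = trans (cong ⟦_⟧ (codes-intro {a List.∷ U} {Y} {a} YEa (Any.here refl)))
                            (cong (λ b → 1 + ⟦ b ⟧) (sym (≢true⇒≡false notU)))
        where
        notU : codes U Y ≢ true
        notU p = let b , c , b∈U = codes-elim {F = U} {Y} p in All.lookup a∉U b∈U (encodes-injective {Y} {a} {b} YEa c)
      go (no X≢Y) = ≤-antisym (⟦⟧-mono fromCons) (⟦⟧-mono toCons)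
        where
        fromCons : codes (a List.∷ U) X ≡ true → codes U X ≡ true
        fromCons p = inTail (codes-elim {F = a List.∷ U} {X} p)
          where
          inTail : ∃[ b ] (X Encodes b × b ∈ (a List.∷ U)) → codes U X ≡ true
          inTail (b , c , Any.here refl)  = contradiction (encodes-functional {X} {Y} {a} c YEa) X≢Y
          inTail (b , c , Any.there b∈U) = codes-intro {U} {X} {b} c b∈U
        toCons : codes U X ≡ true → codes (a List.∷ U) X ≡ true
        toCons p = let b , c , b∈U = codes-elim {F = U} {X} p in codes-intro {a List.∷ U} {X} {b} c (Any.there b∈U)

  -- Two members through a centre among the last κ points could be chosen with no other common point,
  -- so the multisets they encode would be disjoint.
  centre-in-support : ∀ {F : Family m} → Intersecting F → Roomy κ (m + κ) → ∀ {x y} → x ≢ y →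
    (∀ X → ∣ X ∣ ≡ suc κ → lookup X x ≡ true → lookup X y ≡ false → codes F X ≡ true) →
    ∃[ i ] (i ↑ˡ κ ≡ x)
  centre-in-support {F} int roomy {x} {y} x≢y full = located
      (common-support {F = F} int {insert x Y} {insert x Y′} (member {Y} vY) (member {Y′} vY′))
    where
    V : Subset (m + κ)
    V = insert x (insert y ∅ˢ)
    ∣V∣≤2 : ∣ V ∣ ≤ 2
    ∣V∣≤2 = ≤-trans (∣insert∣≤ x (insert y ∅ˢ)) (s≤s (≤-trans (∣insert∣≤ y ∅ˢ) (s≤s (≤-reflexive (∣∅∣ (m + κ))))))
    found : ∃[ Y ] (∣ Y ∣ ≡ κ × Disjoint V Y)
    found = avoid κ V (roomy V (≤-trans ∣V∣≤2 (s≤s (s≤s z≤n))))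
    Y : Subset (m + κ)
    Y = proj₁ found
    vY : ∣ Y ∣ ≡ κ × Disjoint V Y
    vY = proj₂ found
    found′ : ∃[ Y′ ] (∣ Y′ ∣ ≡ κ × Disjoint (V ∪ˢ Y) Y′)
    found′ = avoid κ (V ∪ˢ Y) (roomy (V ∪ˢ Y) (≤-trans (∣∪∣≤ V Y)
               (+-mono-≤ (≤-trans ∣V∣≤2 (s≤s (s≤s z≤n))) (≤-reflexive (proj₁ vY)))))
    Y′ : Subset (m + κ)
    Y′ = proj₁ found′
    vY′ : ∣ Y′ ∣ ≡ κ × Disjoint V Y′
    vY′ = proj₁ (proj₂ found′) , disjoint-∪ˡ {X = V} {Y} {Y′} (proj₂ (proj₂ found′))
    Y#Y′ : Disjoint Y Y′
    Y#Y′ = disjoint-∪ʳ {X = V} {Y} {Y′} (proj₂ (proj₂ found′))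
    member : ∀ {Z} → ∣ Z ∣ ≡ κ × Disjoint V Z → codes F (insert x Z) ≡ true
    member {Z} (∣Z∣ , V#Z) = full (insert x Z)
      (trans (∣insert∣ x Z (V#Z x (insert-∋ x (insert y ∅ˢ)))) (cong suc ∣Z∣)) (insert-∋ x Z)
      (trans (insert-≢ Z (x≢y ∘ sym)) (V#Z y (insert-⊇ (insert y ∅ˢ) (insert-∋ y ∅ˢ))))
    located : ∃[ i ] (lookup (insert x Y) (i ↑ˡ κ) ≡ true × lookup (insert x Y′) (i ↑ˡ κ) ≡ true) → ∃[ i ] (i ↑ˡ κ ≡ x)
    located (i , p , q) with (i ↑ˡ κ) Fin.≟ x
    ... | yes e = i , e
    ... | no ≢x = contradiction (trans (sym (insert-≢ Y′ ≢x)) q)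
                    (false≢true (Y#Y′ (i ↑ˡ κ) (trans (sym (insert-≢ Y ≢x)) p)))

-- For k = 2 + e, assuming M ≤ k + 1 gives M² ≤ kM + M ≤ kM + k + 1, and k + 1 ≤ k² as k ≥ 2.
golden⇒gap : ∀ e M → Golden (2 + e) M → 4 + e ≤ M
golden⇒gap e M g = ≰⇒> λ M≤ → ≤⇒≯ (begin
  M * M                                          ≤⟨ *-monoˡ-≤ M M≤ ⟩
  (3 + e) * M                                    ≡⟨ +-comm M ((2 + e) * M) ⟩
  (2 + e) * M + M                                ≤⟨ +-monoʳ-≤ ((2 + e) * M) M≤ ⟩
  (2 + e) * M + (3 + e)                          ≤⟨ +-monoʳ-≤ ((2 + e) * M) (≤-trans (m≤m+n (3 + e) _) (≤-reflexive (poly e))) ⟩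
  (2 + e) * M + (2 + e) * (2 + e)                ∎) g
  where
  open ≤-Reasoning
  poly : ∀ e → 3 + e + (1 + 3 * e + e * e) ≡ (2 + e) * (2 + e)
  poly = solve-∀

-- For κ ≥ 1 the gap M ≥ κ + 3 yields n = M + κ + 1 ≥ 2κ + 4. For κ = 0 the claim only says that a
-- subset has at most n points.
golden⇒roomy : ∀ {κ M} → Golden (suc κ) M → Roomy κ (suc (M + κ))
golden⇒roomy {zero}  {M} g W ∣W∣≤ = ∣p∣≤n W
golden⇒roomy {suc e} {M} g W ∣W∣≤ = begin
  suc e + ∣ W ∣         ≤⟨ +-monoʳ-≤ (suc e) ∣W∣≤ ⟩
  suc e + (4 + suc e)   ≡⟨ rearrange e ⟩
  suc (4 + e + suc e)   ≤⟨ s≤s (+-monoˡ-≤ (suc e) (golden⇒gap e M g)) ⟩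
  suc (M + suc e)       ∎
  where
  open ≤-Reasoning
  rearrange : ∀ e → suc e + (4 + suc e) ≡ suc (4 + e + suc e)
  rearrange = solve-∀

-- Return to multisets

module Reduction (M′ κ : ℕ) (golden : Golden (suc κ) (suc M′)) where

  private
    k N : ℕ
    k = suc κ
    N = M′ + κ
    m′ : ℕ
    m′ = suc (suc M′)

  open Encoding m′ κ

  module _ {F₁ F₂ U : Family m′} (ms₁ : FamilyOfKMultisets k F₁) (ms₂ : FamilyOfKMultisets k F₂)
           (int₁ : Intersecting F₁) (int₂ : Intersecting F₂)
           (uU : Unique U) (U⇔ : ∀ A → (A ∈ U) ⇔ (A ∈ F₁ ⊎ A ∈ F₂)) where

    private
      S : ℕ
      S = binomial (suc N) κ + binomial N κ

      roomy : Roomy κ (suc (suc N))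
      roomy = golden⇒roomy {κ} {suc M′} golden

      A B : SetFamily (m′ + κ)
      A = codes F₁
      B = codes F₂

      U-ms : FamilyOfKMultisets k U
      U-ms {a} a∈U = [ ms₁ , ms₂ ]′ (Equivalence.to (U⇔ a) a∈U)

      ∪⇒U : ∀ {X} → (A ∪ᶠ B) X ≡ true → codes U X ≡ true
      ∪⇒U {X} p with ∨-elim {A X} p
      ... | inj₁ q = let a , c , a∈F = codes-elim {F₁} {X} q in codes-intro {U} {X} {a} c (Equivalence.from (U⇔ a) (inj₁ a∈F))
      ... | inj₂ q = let a , c , a∈F = codes-elim {F₂} {X} q in codes-intro {U} {X} {a} c (Equivalence.from (U⇔ a) (inj₂ a∈F))

      U⇒∪ : ∀ {X} → codes U X ≡ true → (A ∪ᶠ B) X ≡ true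
      U⇒∪ {X} p = let a , c , a∈U = codes-elim {U} {X} p in
        [ (λ a∈F → ∨-introˡ (codes-intro {F₁} {X} {a} c a∈F))
        , (λ a∈F → ∨-introʳ {A X} (codes-intro {F₂} {X} {a} c a∈F)) ]′ (Equivalence.to (U⇔ a) a∈U)

      level≡length : level k (A ∪ᶠ B) ≡ length U
      level≡length = trans (≤-antisym (level-mono k {A ∪ᶠ B} {codes U} (λ X _ → ∪⇒U {X}))
                                      (level-mono k {codes U} {A ∪ᶠ B} (λ X _ → U⇒∪ {X})))
                           (level-codes U uU U-ms)

      best = optimal {N} {κ} {suc M′} (cong suc (+-suc M′ κ)) golden roomy {A} {B}
               (λ {X} → codes-uniform F₁ {X}) (λ {X} → codes-uniform F₂ {X})
               (λ {X} {Y} → codes-intersecting {F₁} int₁ {X} {Y}) (λ {X} {Y} → codes-intersecting {F₂} int₂ {X} {Y})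

      Hits : Fin m′ → Fin m′ → Set
      Hits x y = ∀ A → (A ∈ U) ⇔ (IsKMultiset k A × (1 ≤ mult x A ⊎ 1 ≤ mult y A))

    length-bound : length U ≤ S
    length-bound = subst (_≤ S) level≡length (proj₁ best)

    -- The centres found by `optimal` are points of [m+k-1]. Since each family contains every k-set
    -- through its own centre that avoids the other centre, `centre-in-support` moves both centres
    -- into [m], where membership in a code means positive multiplicity.
    extremal⇒star : length U ≡ S → Σ[ x ∈ Fin m′ ] Σ[ y ∈ Fin m′ ] (¬ (x ≡ y) × Hits x y)
    extremal⇒star eq = centres (proj₂ best S≤)
      where
      S≤ : S ≤ level k (A ∪ᶠ B)
      S≤ = ≤-reflexive (trans (sym eq) (sym level≡length))
      centres : ∃[ x ] ∃[ y ] (x ≢ y × Star k x A × Star k y B) → Σ[ x ∈ Fin m′ ] Σ[ y ∈ Fin m′ ] (¬ (x ≡ y) × Hits x y)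
      centres (x , y , x≢y , sA , sB) = conclude
          (centre-in-support {F₁} int₁ roomy {x} {y} x≢y fullA) (centre-in-support {F₂} int₂ roomy {y} {x} (x≢y ∘ sym) fullB)
        where
        full : ∀ X → ∣ X ∣ ≡ k → star₂ x y X ≡ true → (A ∪ᶠ B) X ≡ true
        full = stars-full (cong suc (+-suc M′ κ)) golden roomy {A} {B} {x} {y} x≢y
                 (stars-⊆ (cong suc (+-suc M′ κ)) golden roomy {A} {B} {x} {y} sA sB) S≤
        fullA : ∀ X → ∣ X ∣ ≡ k → lookup X x ≡ true → lookup X y ≡ false → A X ≡ true
        fullA X e Xx Xy = [ (λ p → p) , (λ BX → contradiction (sB X e BX) (false≢true Xy)) ]′
                            (∨-elim {A X} (full X e (∨-introˡ Xx)))
        fullB : ∀ X → ∣ X ∣ ≡ k → lookup X y ≡ true → lookup X x ≡ false → B X ≡ true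
        fullB X e Xy Xx = [ (λ AX → contradiction (sA X e AX) (false≢true Xx)) , (λ p → p) ]′
                            (∨-elim {A X} (full X e (∨-introʳ {lookup X x} Xy)))
        conclude : ∃[ i ] (i ↑ˡ κ ≡ x) → ∃[ j ] (j ↑ˡ κ ≡ y) → Σ[ x ∈ Fin m′ ] Σ[ y ∈ Fin m′ ] (¬ (x ≡ y) × Hits x y)
        conclude (i , refl) (j , refl) = i , j , (x≢y ∘ cong (_↑ˡ κ)) , λ a → mk⇔ (to a) (from a)
          where
          to : ∀ a → a ∈ U → IsKMultiset k a × (1 ≤ mult i a ⊎ 1 ≤ mult j a)
          to a a∈U = U-ms a∈U , hit (encoding a (U-ms a∈U))
            where
            hit : ∃[ X ] (X Encodes a) → 1 ≤ mult i a ⊎ 1 ≤ mult j a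
            hit (X , c) = [ (λ AX → inj₁ (Equivalence.from (encodes-support {X} {a} c i) (sA X (encodes-size {X} {a} c) AX)))
                          , (λ BX → inj₂ (Equivalence.from (encodes-support {X} {a} c j) (sB X (encodes-size {X} {a} c) BX))) ]′
                          (∨-elim {A X} (U⇒∪ {X} (codes-intro {U} {X} {a} c a∈U)))
          from : ∀ a → IsKMultiset k a × (1 ≤ mult i a ⊎ 1 ≤ mult j a) → a ∈ U
          from a (ka , hits) = member (encoding a ka)
            where
            member : ∃[ X ] (X Encodes a) → a ∈ U
            member (X , c) =
              let inStar = [ (λ ai → ∨-introˡ (Equivalence.to (encodes-support {X} {a} c i) ai))
                           , (λ aj → ∨-introʳ {lookup X (i ↑ˡ κ)} (Equivalence.to (encodes-support {X} {a} c j) aj)) ]′ hits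
                  b , c′ , b∈U = codes-elim {U} {X} (∪⇒U {X} (full X (encodes-size {X} {a} c) inStar))
              in subst (_∈ U) (encodes-injective {X} {b} {a} c′ c) b∈U

    star⇒extremal : Σ[ x ∈ Fin m′ ] Σ[ y ∈ Fin m′ ] (¬ (x ≡ y) × Hits x y) → length U ≡ S
    star⇒extremal (x , y , x≢y , hits) = ≤-antisym length-bound (begin
      S                                      ≡⟨ level-star₂ N κ (x ↑ˡ κ) (y ↑ˡ κ) (x≢y ∘ ↑ˡ-injective κ x y) ⟨
      level k (star₂ (x ↑ˡ κ) (y ↑ˡ κ))      ≤⟨ level-mono k {star₂ (x ↑ˡ κ) (y ↑ˡ κ)} {codes U} inU ⟩
      level k (codes U)                      ≡⟨ level-codes U uU U-ms ⟩
      length U                               ∎)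
      where
      open ≤-Reasoning
      inU : ∀ X → ∣ X ∣ ≡ k → star₂ (x ↑ˡ κ) (y ↑ˡ κ) X ≡ true → codes U X ≡ true
      inU X e p = let a , c = decoding X e in codes-intro {U} {X} {a} c (Equivalence.from (hits a) (encodes-sum {X} {a} c ,
        [ (λ q → inj₁ (Equivalence.from (encodes-support {X} {a} c x) q))
        , (λ q → inj₂ (Equivalence.from (encodes-support {X} {a} c y) q)) ]′ (∨-elim {lookup X (x ↑ˡ κ)} p)))

theorem3p5 : (k m : ℕ) → 1 ≤ k → 1 ≤ m
    → (F₁ F₂ : Family m)
    → FamilyOfKMultisets k F₁ → FamilyOfKMultisets k F₂
    → Intersecting F₁ → Intersecting F₂
    → (U : Family m) → Unique U → (∀ A → (A ∈ U) ⇔ (A ∈ F₁ ⊎ A ∈ F₂))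
    → (m ∸ 1) * k + k * k < (m ∸ 1) * (m ∸ 1)
    → (length U ≤ ((m + k ∸ 2) C (k ∸ 1)) + ((m + k ∸ 3) C (k ∸ 1)))
    × ((length U ≡ ((m + k ∸ 2) C (k ∸ 1)) + ((m + k ∸ 3) C (k ∸ 1)))
    ⇔ (Σ[ x ∈ Fin m ] Σ[ y ∈ Fin m ] (¬ (x ≡ y) × (∀ A → (A ∈ U) ⇔
    (IsKMultiset k A × (1 ≤ mult x A ⊎ 1 ≤ mult y A))))))
-- For m = 1 the hypothesis `h` would put a number below 0, so m - 1 is a successor.
theorem3p5 (suc κ) (suc (suc M′)) 1≤k 1≤m F₁ F₂ ms₁ ms₂ int₁ int₂ U uU U⇔ h
  -- m + k - 2 computes to `M′ + suc κ`; rewriting it as a successor also lets m + k - 3 compute to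
  -- `M′ + κ`, the `N` of `Reduction`.
  rewrite +-suc M′ κ | sym (binomial≡C (suc (M′ + κ)) κ) | sym (binomial≡C (M′ + κ) κ) =
    length-bound ms₁ ms₂ int₁ int₂ uU U⇔
  , mk⇔ (extremal⇒star ms₁ ms₂ int₁ int₂ uU U⇔) (star⇒extremal ms₁ ms₂ int₁ int₂ uU U⇔)
  where
  golden : Golden (suc κ) (suc M′)
  golden = subst (λ p → p + suc κ * suc κ < suc M′ * suc M′) (*-comm (suc M′) (suc κ)) h
  open Reduction M′ κ golden
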